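{- Let $r>0$ be an integer and let $(s_n(x))_{n\ge 0}$ be the sequence of polynomials extending the path counts $s_n(m)=s_n(m;r)$ described in the context. Then for every integer $n\ge 0$, as an identity of rational functions in $x$, $$s_{n}(x)=\frac{x-n+1}{x+1}\binom{x+1}{n}_{r}=\frac{x-n+1}{x+1}\sum_{i=0}^{\lfloor n/r\rfloor}(-1)^{i}\binom{x+1}{i}\binom{x+n-ri}{n-ri}.$$
   Context: Path counts. For $(n,m)\in\mathbb{Z}^2$, $s_n(m)=s_n(m;r)$ is the number of lattice paths from $(0,0)$ to $(n,m)$ with unit steps $\uparrow=(0,1)$ and $\rightarrow=(1,0)$ that stay weakly above the diagonal $y=x$ and contain no $r$ consecutive $\rightarrow$ steps. In particular $s_0(m)=1$ for all $m\ge 0$, $s_n(m)=0$ if $n<0$, and $s_n(m)=0$ if $m+1=n>0$. Extension. These path counts (used for $m\ge n\ge 0$, together with $s_n(n-1)=0$ for $n>0$) are extended to all integers $m$ as follows: $s_n(m)=0$ for all $m$ if $n<0$; $s_0(m)=1$ for all $m\in\mathbb{Z}$; and for $n>0$ the values $s_n(m)$ with $m<n-1$ are defined by requiring the recurrence $s_{n}(m)=s_{n-1}(m)+s_{n}(m-1)-s_{n-r}(m-1)$ to hold for all $m\in\mathbb{Z}$. For each $n\ge 0$ the function $m\mapsto s_n(m)$ on $\mathbb{Z}$ is then given by a polynomial, and $s_n(x)$ denotes this polynomial in a real variable $x$. Euler coefficient. $\binom{x}{n}_r=[t^n](1+t+\cdots+t^{r-1})^x$, the coefficient of $t^n$ in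 the formal power series; it is a polynomial in $x$. Ordinary binomial coefficients $\binom{x}{k}$ are the usual polynomials in $x$. -}

module Defs where

open import Data.Nat as ℕ using (ℕ; zero; suc; pred; NonZero)
import Data.Nat.Properties as ℕₚ
open import Data.Integer as ℤ using (ℤ; +_; -[1+_])
import Data.Integer.Properties as ℤₚ
open import Data.Integer.Tactic.RingSolver using (solve-∀)
open import Data.Rational as ℚ using (ℚ; 0ℚ; 1ℚ; _/_)
open import Data.List using (List; []; _∷_; _++_; map; length; filter; replicate; inits)
open import Data.List.Relation.Unary.All using (All; all?)
open import Data.List.Relation.Binary.Infix.Heterogeneous using (Infix)
open import Data.List.Relation.Binary.Infix.Heterogeneous.Properties using (infix?)
open import Data.Product using (_×_)
open import Relation.Nullary using (¬_; Dec; yes; no)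
open import Relation.Nullary.Decidable using (¬?; _×-dec_)
open import Relation.Binary.PropositionalEquality
  using (_≡_; refl; sym; trans; cong; cong₂; module ≡-Reasoning)

------------------------------------------------------------------------
-- Lattice paths

data Step : Set where
  up right : Step

_≟ˢ_ : (a b : Step) → Dec (a ≡ b)
up    ≟ˢ up    = yes refl
up    ≟ˢ right = no λ ()
right ≟ˢ up    = no λ ()
right ≟ˢ right = yes refl

#_∈_ : Step → List Step → ℕ
# a ∈ w = length (filter (a ≟ˢ_) w)

EndsAt : ℕ → ℕ → List Step → Set
EndsAt n m w = (# right ∈ w ≡ n) × (# up ∈ w ≡ m)

-- The points visited by a path are the end points of its prefixes.
WeaklyAboveDiagonal : List Step → Set
WeaklyAboveDiagonal w = All (λ v → # right ∈ v ℕ.≤ # up ∈ v) (inits w)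

HasRightRun : ℕ → List Step → Set
HasRightRun r w = Infix _≡_ (replicate r right) w

IsPath : ℕ → ℕ → ℕ → List Step → Set
IsPath r n m w = EndsAt n m w × WeaklyAboveDiagonal w × ¬ HasRightRun r w

isPath? : ∀ r n m w → Dec (IsPath r n m w)
isPath? r n m w =
  ((# right ∈ w ℕ.≟ n) ×-dec (# up ∈ w ℕ.≟ m))
  ×-dec all? (λ v → # right ∈ v ℕ.≤? # up ∈ v) (inits w)
  ×-dec ¬? (infix? _≟ˢ_ (replicate r right) w)

words : ℕ → List (List Step)
words zero    = [] ∷ []
words (suc k) = map (up ∷_) (words k) ++ map (right ∷_) (words k)

pathCount : ℕ → ℕ → ℕ → ℕ
pathCount r n m = length (filter (isPath? r n m) (words (n ℕ.+ m)))

------------------------------------------------------------------------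
-- Extension of the path counts to all integers

-- The row m ↦ s₍ₙ₊₁₎(m), given the rows prev = sₙ and prevr = s₍ₙ₊₁₋ᵣ₎.
-- Below the diagonal it is obtained by solving
--   s₍ₙ₊₁₎(m) = sₙ(m) + s₍ₙ₊₁₎(m-1) - s₍ₙ₊₁₋ᵣ₎(m-1)
-- for s₍ₙ₊₁₎(m-1), starting from s₍ₙ₊₁₎(n) = 0.
module Row (r n : ℕ) (prev prevr : ℤ → ℤ) where

  -- below k = s₍ₙ₊₁₎(n-k)
  below : ℕ → ℤ
  below zero    = + 0
  below (suc k) = below k ℤ.- prev (+ n ℤ.- + k) ℤ.+ prevr (+ n ℤ.- + suc k)

  -- fromDiagonal d = s₍ₙ₊₁₎(n+d)
  fromDiagonal : ℤ → ℤ
  fromDiagonal (+ zero)  = below 0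
  fromDiagonal (+ suc j) = + pathCount r (suc n) (n ℕ.+ suc j)
  fromDiagonal -[1+ k ]  = below (suc k)

  row : ℤ → ℤ
  row m = fromDiagonal (m ℤ.- + n)

-- sBack r n d = s₍ₙ₋d₎, which is 0 for d > n.  Carrying all the earlier rows
-- makes the recursion structural; s₍ₙ₊₁₋ᵣ₎ is sBack r n (r - 1), as r > 0.
sBack : ℕ → ℕ → ℕ → ℤ → ℤ
sBack r zero    zero    = λ _ → + 1
sBack r zero    (suc d) = λ _ → + 0
sBack r (suc n) zero    = Row.row r n (sBack r n 0) (sBack r n (pred r))
sBack r (suc n) (suc d) = sBack r n d

s : ℕ → ℤ → ℤ → ℤ
s r (+ n)    m = sBack r n 0 m
s r -[1+ _ ] m = + 0

sBack-s : ∀ r n d m → sBack r n d m ≡ s r (n ℤ.⊖ d) m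
sBack-s r zero    zero    m = refl
sBack-s r zero    (suc d) m = refl
sBack-s r (suc n) zero    m = refl
sBack-s r (suc n) (suc d) m =
  trans (sBack-s r n d m) (cong (λ i → s r i m) (sym (ℤₚ.[1+m]⊖[1+n]≡m⊖n n d)))

s-onOrAbove : ∀ r n j → s r (+ suc n) (+ suc n ℤ.+ + j) ≡ + pathCount r (suc n) (suc n ℕ.+ j)
s-onOrAbove r n j = begin
  fromDiagonal (+ suc n ℤ.+ + j ℤ.- + n)    ≡⟨ cong fromDiagonal (lem (+ n) (+ j)) ⟩
  fromDiagonal (+ suc j)                    ≡⟨ cong (λ i → + pathCount r (suc n) i) (ℕₚ.+-suc n j) ⟩
  + pathCount r (suc n) (suc n ℕ.+ j)       ∎
  where
  open ≡-Reasoning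
  open Row r n (sBack r n 0) (sBack r n (pred r))
  lem : ∀ a b → (+ 1 ℤ.+ a) ℤ.+ b ℤ.- a ≡ + 1 ℤ.+ b
  lem = solve-∀

s-recurrence-below : ∀ r .{{_ : NonZero r}} n k → let m = + n ℤ.- + k in
  s r (+ suc n) m ≡
  s r (+ n) m ℤ.+ s r (+ suc n) (m ℤ.- + 1) ℤ.- s r (+ suc n ℤ.- + r) (m ℤ.- + 1)
s-recurrence-below (suc r′) n k = begin
  s r (+ suc n) m                       ≡⟨ row-below k ⟩
  below k                               ≡⟨ solved (below k) (prev m) (prevr m′) ⟩
  prev m ℤ.+ below (suc k) ℤ.- prevr m′
    ≡⟨ cong₂ (λ x y → prev m ℤ.+ x ℤ.- y)
             (trans (sym (row-below (suc k))) (cong (s r (+ suc n)) (sym m-1≡m′)))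
             (trans (sBack-s r n r′ m′)
                    (cong₂ (s r) (sym (ℤₚ.[1+m]⊖[1+n]≡m⊖n n r′)) (sym m-1≡m′))) ⟩
  s r (+ n) m ℤ.+ s r (+ suc n) (m ℤ.- + 1) ℤ.- s r (+ suc n ℤ.- + r) (m ℤ.- + 1) ∎
  where
  open ≡-Reasoning
  r = suc r′
  prev  = sBack r n 0
  prevr = sBack r n r′
  open Row r n prev prevr
  m  = + n ℤ.- + k
  m′ = + n ℤ.- + suc k
  m-1≡m′ : m ℤ.- + 1 ≡ m′
  m-1≡m′ = lem (+ n) (+ k)
    where
    lem : ∀ a b → a ℤ.- b ℤ.- + 1 ≡ a ℤ.- (+ 1 ℤ.+ b)
    lem = solve-∀
  diag : ∀ a b → a ℤ.- b ℤ.- a ≡ ℤ.- b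
  diag = solve-∀
  neg : ∀ k → fromDiagonal (ℤ.- + k) ≡ below k
  neg zero    = refl
  neg (suc k) = refl
  row-below : ∀ k → row (+ n ℤ.- + k) ≡ below k
  row-below k = trans (cong fromDiagonal (diag (+ n) (+ k))) (neg k)
  solved : ∀ b p q → b ≡ p ℤ.+ (b ℤ.- p ℤ.+ q) ℤ.- q
  solved = solve-∀

------------------------------------------------------------------------
-- Polynomials over ℚ: coefficient lists, constant term first

Poly : Set
Poly = List ℚ

coeff : Poly → ℕ → ℚ
coeff []      _       = 0ℚ
coeff (a ∷ p) zero    = a
coeff (a ∷ p) (suc k) = coeff p k

-- Trailing zeros are allowed, so equality is coefficientwise.
infix 4 _≈ₚ_
_≈ₚ_ : Poly → Poly → Set
p ≈ₚ q = ∀ k → coeff p k ≡ coeff q k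

eval : Poly → ℚ → ℚ
eval []      x = 0ℚ
eval (a ∷ p) x = a ℚ.+ x ℚ.* eval p x

const : ℚ → Poly
const a = a ∷ []

X : Poly
X = 0ℚ ∷ 1ℚ ∷ []

infixl 6 _+ₚ_ _-ₚ_
infixl 7 _*ₚ_ _·ₚ_
infixr 8 _^ₚ_

_+ₚ_ : Poly → Poly → Poly
[]      +ₚ q       = q
(a ∷ p) +ₚ []      = a ∷ p
(a ∷ p) +ₚ (b ∷ q) = (a ℚ.+ b) ∷ (p +ₚ q)

_·ₚ_ : ℚ → Poly → Poly
a ·ₚ p = map (a ℚ.*_) p

_-ₚ_ : Poly → Poly → Poly
p -ₚ q = p +ₚ (ℚ.- 1ℚ) ·ₚ q

_*ₚ_ : Poly → Poly → Poly
[]      *ₚ q = []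
(a ∷ p) *ₚ q = a ·ₚ q +ₚ (0ℚ ∷ (p *ₚ q))

_^ₚ_ : Poly → ℕ → Poly
p ^ₚ zero  = const 1ℚ
p ^ₚ suc k = p *ₚ p ^ₚ k

ι : ℤ → ℚ
ι m = m / 1

nat : ℕ → Poly
nat k = const (ι (+ k))

-- ∑≤ N f = f 0 + f 1 + … + f N
∑≤ : ℕ → (ℕ → Poly) → Poly
∑≤ zero    f = f 0
∑≤ (suc N) f = ∑≤ N f +ₚ f (suc N)

-- binom p k = p (p-1) ⋯ (p-k+1) / k!
binom : Poly → ℕ → Poly
binom p zero    = const 1ℚ
binom p (suc k) = (+ 1 / suc k) ·ₚ (binom p k *ₚ (p -ₚ nat k))

-- [tⁿ] f(t)ᵖ for a polynomial f with constant term 1 and an exponent p in ℚ[x],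
-- where fᵖ = Σₖ binom p k (f-1)ᵏ.  As t divides f-1, only k ≤ n contribute.
[t^_]_^_ : ℕ → Poly → Poly → Poly
[t^ n ] f ^ p = ∑≤ n λ k → coeff ((f -ₚ const 1ℚ) ^ₚ k) n ·ₚ binom p k

-- replicate r 1ℚ is 1 + t + ⋯ + tʳ⁻¹.
eulerCoeff : ℕ → Poly → ℕ → Poly
eulerCoeff r p n = [t^ n ] replicate r 1ℚ ^ p

------------------------------------------------------------------------
-- Rational functions over ℚ

record RatFun : Set where
  constructor _÷_[_]
  field
    num   : Poly
    den   : Poly
    den≉0 : ¬ (den ≈ₚ [])

open RatFun public

infix 4 _≈_
_≈_ : RatFun → RatFun → Set
f ≈ g = num f *ₚ den g ≈ₚ num g *ₚ den f

fromPoly : Poly → RatFun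
fromPoly p = p ÷ const 1ℚ [ (λ eq → 1≢0 (eq 0)) ]
  where
  1≢0 : ¬ (1ℚ ≡ 0ℚ)
  1≢0 ()

infixl 7 _*ᵣ_
_*ᵣ_ : RatFun → Poly → RatFun
f *ᵣ p = (num f *ₚ p) ÷ den f [ den≉0 f ]

_/x+1 : Poly → RatFun
p /x+1 = p ÷ X +ₚ nat 1 [ (λ eq → 1≢0 (eq 1)) ]
  where
  1≢0 : ¬ (1ℚ ≡ 0ℚ)
  1≢0 ()

------------------------------------------------------------------------

-- S n is the polynomial whose values at the integers m are sₙ(m).
Extends : ℕ → (ℕ → Poly) → Set
Extends r S = ∀ n m → eval (S n) (ι m) ≡ ι (s r (+ n) m)

{-# OPTIONS --safe #-}
module Submission where

-- Write f = 1 + t + ... + t^(r-1).  Polynomials in x are compared through their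
-- values: two polynomials over the rationals that agree at all naturals m >= n
-- have the same coefficients (identity-theorem).  So x is replaced by a natural
-- m >= n, where s_n(m) is an honest path count, and everything becomes a
-- statement about the coefficients of the powers f^k, k natural.
--
-- Path counts.  Let p(n,m) be the number of paths to (n,m).  Removing the final
-- run of i < r right steps together with the up step before it gives
--   p(n,m+1) = sum over i < r of p(n-i,m)       for n <= m+1   (paths-suc),
-- with p(k,m) = 0 for k < 0.  So the row m+1 is f times the row m, up to the
-- coefficient of t^(m+1).  The sequence
--   b(m) = (f - t f') f^m                        (ballot)
-- satisfies the same recurrence, since multiplications commute.  As t d/dt is a
-- derivation, t (f^(m+1))' = (m+1) t f' f^m, hence
--   (m+1) [t^n] b(m) = (m+1-n) [t^n] f^(m+1)     (ballot-formula).
-- In particular [t^(m+1)] b(m) = 0 = p(m+1,m), so the two agree on the line just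
-- below the diagonal, and p(n,m) = [t^n] b(m) for all n <= m+1 (paths≡ballot).
-- This is the first identity, once eulerCoeff at x+1 = m+1 is recognised as
-- [t^n] f^(m+1) by the binomial theorem (^ₚ-expansion).
--
-- The sum.  From (1-t) f = 1 - t^r follows f^(m+1) = (1-t^r)^(m+1) (1-t)^(-m-1).
-- The coefficients of (1-t)^(-m-1) are the binomials bin (m+j) j, and the power
-- (1-t^r)^(m+1) is expanded by the same binomial theorem (ones-^ₚ-explicit).

open import Defs
open import Data.Nat using (ℕ; zero; suc; _+_; _*_; _∸_; _/_; _≤_; _<_; _≟_; _≤?_; z≤n; s≤s; NonZero; ≢-nonZero⁻¹)
import Data.Nat.Properties as ℕₚ
import Data.Nat.DivMod as DivMod
open import Data.Integer as ℤ using (+_)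
open import Data.Integer.Tactic.RingSolver using (solve-∀)
open import Data.Rational as ℚ using (ℚ; 0ℚ; 1ℚ; -_)
import Data.Rational.Properties as ℚₚ
import Data.Rational.Unnormalised as ℚᵘ
import Data.Rational.Unnormalised.Properties as ℚᵘₚ
open import Data.Rational.Solver using (module +-*-Solver)
open +-*-Solver using (solve; con; _:+_; _:*_; _:-_; _:=_)
open import Data.List using (List; []; _∷_; _++_; _∷ʳ_; map; replicate; length; filter; inits)
import Data.List.Properties as Listₚ
open import Data.List.Relation.Unary.All as All using (All; []; _∷_; all?)
import Data.List.Relation.Unary.All.Properties as Allₚ
open import Data.List.Relation.Binary.Infix.Heterogeneous using (here; there; _ⁱ++_)
open import Data.List.Relation.Binary.Infix.Heterogeneous.Properties using (infix?; length-mono)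
open import Data.List.Relation.Binary.Prefix.Heterogeneous using (Prefix; []; _∷_)
import Data.List.Relation.Binary.Prefix.Heterogeneous.Properties as Prefixₚ
import Data.List.Relation.Binary.Pointwise as Pointwise
open import Algebra.Properties.CommutativeSemigroup ℕₚ.+-commutativeSemigroup using (interchange)
open import Data.Product using (_×_; _,_; proj₁; proj₂)
open import Data.Sum using (_⊎_; inj₁; inj₂)
open import Data.Empty using (⊥-elim)
open import Function using (_∘_)
open import Relation.Nullary using (¬_; yes; no)
open import Relation.Nullary.Decidable using (¬?; _×-dec_)
open import Relation.Unary using (Decidable; _≐_)
open import Relation.Binary.PropositionalEquality
open ≡-Reasoning

------------------------------------------------------------------------
-- Naturals as rationals

-- The naturals inside the rationals.
fromℕ : ℕ → ℚ
fromℕ k = ι (+ k)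

fromℕ-suc : ∀ k → fromℕ (suc k) ≡ 1ℚ ℚ.+ fromℕ k
fromℕ-suc k = ℚₚ.toℚᵘ-injective (ℚᵘₚ.≃-trans (ℚₚ.toℚᵘ-fromℚᵘ (ℚᵘ.mkℚᵘ (+ suc k) 0))
  (ℚᵘₚ.≃-sym (ℚᵘₚ.≃-trans (ℚₚ.toℚᵘ-homo-+ 1ℚ (fromℕ k))
    (ℚᵘₚ.≃-trans (ℚᵘₚ.+-congʳ ℚᵘ.1ℚᵘ (ℚₚ.toℚᵘ-fromℚᵘ (ℚᵘ.mkℚᵘ (+ k) 0)))
    (ℚᵘ.*≡* (lem (+ k)))))))
  where
  lem : ∀ a → (+ 1 ℤ.* + 1 ℤ.+ a ℤ.* + 1) ℤ.* + 1 ≡ (+ 1 ℤ.+ a) ℤ.* + 1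
  lem = solve-∀

fromℕ-+ : ∀ a b → fromℕ (a + b) ≡ fromℕ a ℚ.+ fromℕ b
fromℕ-+ zero    b = sym (ℚₚ.+-identityˡ (fromℕ b))
fromℕ-+ (suc a) b = begin
  fromℕ (suc (a + b))          ≡⟨ fromℕ-suc (a + b) ⟩
  1ℚ ℚ.+ fromℕ (a + b)         ≡⟨ cong (1ℚ ℚ.+_) (fromℕ-+ a b) ⟩
  1ℚ ℚ.+ (fromℕ a ℚ.+ fromℕ b)    ≡⟨ ℚₚ.+-assoc 1ℚ (fromℕ a) (fromℕ b) ⟨
  (1ℚ ℚ.+ fromℕ a) ℚ.+ fromℕ b    ≡⟨ cong (ℚ._+ fromℕ b) (fromℕ-suc a) ⟨
  fromℕ (suc a) ℚ.+ fromℕ b       ∎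

fromℕ-inverse : ∀ k → fromℕ (suc k) ℚ.* (+ 1 ℚ./ suc k) ≡ 1ℚ
fromℕ-inverse k = ℚₚ.toℚᵘ-injective (ℚᵘₚ.≃-trans (ℚₚ.toℚᵘ-homo-* (fromℕ (suc k)) (+ 1 ℚ./ suc k))
  (ℚᵘₚ.≃-trans (ℚᵘₚ.*-cong (ℚₚ.toℚᵘ-fromℚᵘ (ℚᵘ.mkℚᵘ (+ suc k) 0)) (ℚₚ.toℚᵘ-fromℚᵘ (ℚᵘ.mkℚᵘ (+ 1) k)))
    (ℚᵘ.*≡* (lem (+ suc k)))))
  where
  lem : ∀ a → (a ℤ.* + 1) ℤ.* + 1 ≡ + 1 ℤ.* (+ 1 ℤ.* a)
  lem = solve-∀

fromℕ-suc-cancel : ∀ k {x y} → fromℕ (suc k) ℚ.* x ≡ fromℕ (suc k) ℚ.* y → x ≡ y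
fromℕ-suc-cancel k {x} {y} eq = trans (undo x) (trans (cong ((+ 1 ℚ./ suc k) ℚ.*_) eq) (sym (undo y)))
  where
  undo : ∀ z → z ≡ (+ 1 ℚ./ suc k) ℚ.* (fromℕ (suc k) ℚ.* z)
  undo z = begin
    z                                            ≡⟨ ℚₚ.*-identityˡ z ⟨
    1ℚ ℚ.* z                                     ≡⟨ cong (ℚ._* z) (fromℕ-inverse k) ⟨
    (fromℕ (suc k) ℚ.* (+ 1 ℚ./ suc k)) ℚ.* z
      ≡⟨ solve 3 (λ a b z → (a :* b) :* z := b :* (a :* z)) refl (fromℕ (suc k)) (+ 1 ℚ./ suc k) z ⟩
    (+ 1 ℚ./ suc k) ℚ.* (fromℕ (suc k) ℚ.* z)       ∎

------------------------------------------------------------------------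
-- Polynomials acting on formal power series

-- A sequence stands for the formal power series with these coefficients.
Seq : Set
Seq = ℕ → ℚ

infixl 6 _⊕_
_⊕_ : Seq → Seq → Seq
(g ⊕ h) n = g n ℚ.+ h n

-- Multiplication by t.
shift : Seq → Seq
shift h zero    = 0ℚ
shift h (suc n) = h n

-- act p h is the product of the polynomial p(t) and the series h.
act : Poly → Seq → Seq
act []      h n = 0ℚ
act (a ∷ p) h n = a ℚ.* h n ℚ.+ shift (act p h) n

shift-cong : ∀ {g h} → g ≗ h → shift g ≗ shift h
shift-cong eq zero    = refl
shift-cong eq (suc n) = eq n

shift-⊕ : ∀ g h → shift (g ⊕ h) ≗ shift g ⊕ shift h
shift-⊕ g h zero    = refl
shift-⊕ g h (suc n) = refl

shift-scale : ∀ a h n → shift (λ i → a ℚ.* h i) n ≡ a ℚ.* shift h n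
shift-scale a h zero    = sym (ℚₚ.*-zeroʳ a)
shift-scale a h (suc n) = refl

act-cong : ∀ p {g h} → g ≗ h → act p g ≗ act p h
act-cong []      eq n = refl
act-cong (a ∷ p) eq n = cong₂ ℚ._+_ (cong (a ℚ.*_) (eq n)) (shift-cong (act-cong p eq) n)

act-⊕ : ∀ p g h → act p (g ⊕ h) ≗ act p g ⊕ act p h
act-⊕ []      g h n = refl
act-⊕ (a ∷ p) g h n = begin
  a ℚ.* (g n ℚ.+ h n) ℚ.+ shift (act p (g ⊕ h)) n
    ≡⟨ cong (a ℚ.* (g n ℚ.+ h n) ℚ.+_) (trans (shift-cong (act-⊕ p g h) n) (shift-⊕ (act p g) (act p h) n)) ⟩
  a ℚ.* (g n ℚ.+ h n) ℚ.+ (shift (act p g) n ℚ.+ shift (act p h) n)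
    ≡⟨ solve 5 (λ a g h x y → a :* (g :+ h) :+ (x :+ y) := (a :* g :+ x) :+ (a :* h :+ y)) refl a (g n) (h n) (shift (act p g) n) (shift (act p h) n) ⟩
  (a ℚ.* g n ℚ.+ shift (act p g) n) ℚ.+ (a ℚ.* h n ℚ.+ shift (act p h) n) ∎

act-scale : ∀ p b h n → act p (λ i → b ℚ.* h i) n ≡ b ℚ.* act p h n
act-scale []      b h n = sym (ℚₚ.*-zeroʳ b)
act-scale (a ∷ p) b h n = begin
  a ℚ.* (b ℚ.* h n) ℚ.+ shift (act p (λ i → b ℚ.* h i)) n
    ≡⟨ cong (a ℚ.* (b ℚ.* h n) ℚ.+_) (trans (shift-cong (act-scale p b h) n) (shift-scale b (act p h) n)) ⟩
  a ℚ.* (b ℚ.* h n) ℚ.+ b ℚ.* shift (act p h) n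
    ≡⟨ solve 4 (λ a b h x → a :* (b :* h) :+ b :* x := b :* (a :* h :+ x)) refl a b (h n) (shift (act p h) n) ⟩
  b ℚ.* (a ℚ.* h n ℚ.+ shift (act p h) n) ∎

act-shift : ∀ p h → act p (shift h) ≗ shift (act p h)
act-shift []      h zero    = refl
act-shift []      h (suc n) = refl
act-shift (a ∷ p) h zero    = trans (cong (ℚ._+ 0ℚ) (ℚₚ.*-zeroʳ a)) refl
act-shift (a ∷ p) h (suc n) = cong (a ℚ.* h n ℚ.+_) (act-shift p h n)

act-0 : ∀ p n → act p (λ _ → 0ℚ) n ≡ 0ℚ
act-0 []      n       = refl
act-0 (a ∷ p) zero    = trans (ℚₚ.+-identityʳ (a ℚ.* 0ℚ)) (ℚₚ.*-zeroʳ a)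
act-0 (a ∷ p) (suc n) = trans (cong₂ ℚ._+_ (ℚₚ.*-zeroʳ a) (act-0 p n)) refl

act-comm : ∀ p q h → act p (act q h) ≗ act q (act p h)
act-comm []      q h n = sym (act-0 q n)
act-comm (a ∷ p) q h n = begin
  a ℚ.* act q h n ℚ.+ shift (act p (act q h)) n
    ≡⟨ cong₂ ℚ._+_ (sym (act-scale q a h n)) (trans (shift-cong (act-comm p q h) n) (sym (act-shift q (act p h) n))) ⟩
  act q (λ i → a ℚ.* h i) n ℚ.+ act q (shift (act p h)) n
    ≡⟨ act-⊕ q (λ i → a ℚ.* h i) (shift (act p h)) n ⟨
  act q (act (a ∷ p) h) n ∎

act-+ₚ : ∀ p q h → act (p +ₚ q) h ≗ act p h ⊕ act q h
act-+ₚ []      q       h n = sym (ℚₚ.+-identityˡ (act q h n))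
act-+ₚ (a ∷ p) []      h n = sym (ℚₚ.+-identityʳ (act (a ∷ p) h n))
act-+ₚ (a ∷ p) (b ∷ q) h n = begin
  (a ℚ.+ b) ℚ.* h n ℚ.+ shift (act (p +ₚ q) h) n
    ≡⟨ cong ((a ℚ.+ b) ℚ.* h n ℚ.+_) (trans (shift-cong (act-+ₚ p q h) n) (shift-⊕ (act p h) (act q h) n)) ⟩
  (a ℚ.+ b) ℚ.* h n ℚ.+ (shift (act p h) n ℚ.+ shift (act q h) n)
    ≡⟨ solve 5 (λ a b h x y → (a :+ b) :* h :+ (x :+ y) := (a :* h :+ x) :+ (b :* h :+ y)) refl a b (h n) (shift (act p h) n) (shift (act q h) n) ⟩
  (a ℚ.* h n ℚ.+ shift (act p h) n) ℚ.+ (b ℚ.* h n ℚ.+ shift (act q h) n) ∎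

act-·ₚ : ∀ a p h n → act (a ·ₚ p) h n ≡ a ℚ.* act p h n
act-·ₚ a []      h n = sym (ℚₚ.*-zeroʳ a)
act-·ₚ a (b ∷ p) h n = begin
  (a ℚ.* b) ℚ.* h n ℚ.+ shift (act (a ·ₚ p) h) n
    ≡⟨ cong₂ ℚ._+_ (ℚₚ.*-assoc a b (h n)) (trans (shift-cong (act-·ₚ a p h) n) (shift-scale a (act p h) n)) ⟩
  a ℚ.* (b ℚ.* h n) ℚ.+ a ℚ.* shift (act p h) n
    ≡⟨ ℚₚ.*-distribˡ-+ a (b ℚ.* h n) (shift (act p h) n) ⟨
  a ℚ.* (b ℚ.* h n ℚ.+ shift (act p h) n) ∎

act-*ₚ : ∀ p q h → act (p *ₚ q) h ≗ act p (act q h)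
act-*ₚ []      q h n = refl
act-*ₚ (a ∷ p) q h n = begin
  act (a ·ₚ q +ₚ (0ℚ ∷ (p *ₚ q))) h n
    ≡⟨ act-+ₚ (a ·ₚ q) (0ℚ ∷ (p *ₚ q)) h n ⟩
  act (a ·ₚ q) h n ℚ.+ (0ℚ ℚ.* h n ℚ.+ shift (act (p *ₚ q) h) n)
    ≡⟨ cong₂ ℚ._+_ (act-·ₚ a q h n) (trans (cong (ℚ._+ shift (act (p *ₚ q) h) n) (ℚₚ.*-zeroˡ (h n)))
         (trans (ℚₚ.+-identityˡ _) (shift-cong (act-*ₚ p q h) n))) ⟩
  a ℚ.* act q h n ℚ.+ shift (act p (act q h)) n ∎

coeff-+ₚ : ∀ p q → coeff (p +ₚ q) ≗ coeff p ⊕ coeff q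
coeff-+ₚ []      q       n       = sym (ℚₚ.+-identityˡ (coeff q n))
coeff-+ₚ (a ∷ p) []      n       = sym (ℚₚ.+-identityʳ (coeff (a ∷ p) n))
coeff-+ₚ (a ∷ p) (b ∷ q) zero    = refl
coeff-+ₚ (a ∷ p) (b ∷ q) (suc n) = coeff-+ₚ p q n

coeff-·ₚ : ∀ a p n → coeff (a ·ₚ p) n ≡ a ℚ.* coeff p n
coeff-·ₚ a []      n       = sym (ℚₚ.*-zeroʳ a)
coeff-·ₚ a (b ∷ p) zero    = refl
coeff-·ₚ a (b ∷ p) (suc n) = coeff-·ₚ a p n

coeff-*ₚ : ∀ p q → coeff (p *ₚ q) ≗ act p (coeff q)
coeff-*ₚ []      q n = refl
coeff-*ₚ (a ∷ p) q n = trans (coeff-+ₚ (a ·ₚ q) (0ℚ ∷ (p *ₚ q)) n)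
  (cong₂ ℚ._+_ (coeff-·ₚ a q n) (tail n))
  where
  tail : coeff (0ℚ ∷ (p *ₚ q)) ≗ shift (act p (coeff q))
  tail zero    = refl
  tail (suc n) = coeff-*ₚ p q n

------------------------------------------------------------------------
-- The derivation t d/dt

-- t times the derivative, on polynomials.  The recursion is
-- t (a + t p)' = t (p + t p').
xd : Poly → Poly
xd []      = []
xd (a ∷ p) = 0ℚ ∷ (p +ₚ xd p)

-- t times the derivative, on series.
θ : Seq → Seq
θ h n = fromℕ n ℚ.* h n

θ-shift : ∀ h → θ (shift h) ≗ shift (h ⊕ θ h)
θ-shift h zero    = refl
θ-shift h (suc n) = trans (cong (ℚ._* h n) (fromℕ-suc n)) (solve 2 (λ a h → (con 1ℚ :+ a) :* h := h :+ a :* h) refl (fromℕ n) (h n))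

-- The product rule.
θ-act : ∀ p h → θ (act p h) ≗ act (xd p) h ⊕ act p (θ h)
θ-act []      h n = ℚₚ.*-zeroʳ (fromℕ n)
θ-act (a ∷ p) h n = begin
  fromℕ n ℚ.* (a ℚ.* h n ℚ.+ shift (act p h) n)
    ≡⟨ solve 4 (λ f a h s → f :* (a :* h :+ s) := f :* s :+ a :* (f :* h)) refl (fromℕ n) a (h n) (shift (act p h) n) ⟩
  θ (shift (act p h)) n ℚ.+ a ℚ.* θ h n
    ≡⟨ cong (ℚ._+ a ℚ.* θ h n) (θ-shift (act p h) n) ⟩
  shift (act p h ⊕ θ (act p h)) n ℚ.+ a ℚ.* θ h n
    ≡⟨ cong (ℚ._+ a ℚ.* θ h n) (trans (shift-cong regroup n) (shift-⊕ (act (p +ₚ xd p) h) (act p (θ h)) n)) ⟩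
  shift (act (p +ₚ xd p) h) n ℚ.+ shift (act p (θ h)) n ℚ.+ a ℚ.* θ h n
    ≡⟨ solve 4 (λ s t b h → s :+ t :+ b := (con 0ℚ :* h :+ s) :+ (b :+ t)) refl
         (shift (act (p +ₚ xd p) h) n) (shift (act p (θ h)) n) (a ℚ.* θ h n) (h n) ⟩
  act (xd (a ∷ p)) h n ℚ.+ act (a ∷ p) (θ h) n ∎
  where
  regroup : act p h ⊕ θ (act p h) ≗ act (p +ₚ xd p) h ⊕ act p (θ h)
  regroup i = begin
    act p h i ℚ.+ θ (act p h) i                         ≡⟨ cong (act p h i ℚ.+_) (θ-act p h i) ⟩
    act p h i ℚ.+ (act (xd p) h i ℚ.+ act p (θ h) i)    ≡⟨ ℚₚ.+-assoc (act p h i) (act (xd p) h i) (act p (θ h) i) ⟨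
    act p h i ℚ.+ act (xd p) h i ℚ.+ act p (θ h) i      ≡⟨ cong (ℚ._+ act p (θ h) i) (act-+ₚ p (xd p) h i) ⟨
    act (p +ₚ xd p) h i ℚ.+ act p (θ h) i               ∎

-- t (p^(k+1))' = (k+1) (t p') p^k.
θ-^ₚ : ∀ p k n → θ (coeff (p ^ₚ suc k)) n ≡ fromℕ (suc k) ℚ.* act (xd p) (coeff (p ^ₚ k)) n
θ-^ₚ p k n = begin
  θ (coeff (p ^ₚ suc k)) n                               ≡⟨ cong (fromℕ n ℚ.*_) (coeff-*ₚ p (p ^ₚ k) n) ⟩
  θ (act p (coeff (p ^ₚ k))) n                           ≡⟨ θ-act p (coeff (p ^ₚ k)) n ⟩
  act (xd p) c n ℚ.+ act p (θ c) n                       ≡⟨ cong (act (xd p) c n ℚ.+_) (rest k) ⟩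
  act (xd p) c n ℚ.+ fromℕ k ℚ.* act (xd p) c n
    ≡⟨ solve 2 (λ f x → x :+ f :* x := (con 1ℚ :+ f) :* x) refl (fromℕ k) (act (xd p) c n) ⟩
  (1ℚ ℚ.+ fromℕ k) ℚ.* act (xd p) c n                       ≡⟨ cong (ℚ._* act (xd p) c n) (fromℕ-suc k) ⟨
  fromℕ (suc k) ℚ.* act (xd p) c n                          ∎
  where
  c = coeff (p ^ₚ k)
  θ-one : ∀ i → θ (coeff (const 1ℚ)) i ≡ 0ℚ ℚ.* coeff (const 1ℚ) i
  θ-one zero    = refl
  θ-one (suc i) = trans (ℚₚ.*-zeroʳ (fromℕ (suc i))) (sym (ℚₚ.*-zeroˡ 0ℚ))
  rest : ∀ k → act p (θ (coeff (p ^ₚ k))) n ≡ fromℕ k ℚ.* act (xd p) (coeff (p ^ₚ k)) n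
  rest zero    = begin
    act p (θ (coeff (const 1ℚ))) n               ≡⟨ act-cong p θ-one n ⟩
    act p (λ i → 0ℚ ℚ.* coeff (const 1ℚ) i) n    ≡⟨ act-scale p 0ℚ (coeff (const 1ℚ)) n ⟩
    0ℚ ℚ.* act p (coeff (const 1ℚ)) n            ≡⟨ trans (ℚₚ.*-zeroˡ (act p (coeff (const 1ℚ)) n)) (sym (ℚₚ.*-zeroˡ (act (xd p) (coeff (const 1ℚ)) n))) ⟩
    0ℚ ℚ.* act (xd p) (coeff (const 1ℚ)) n       ∎
  rest (suc k) = begin
    act p (θ (coeff (p ^ₚ suc k))) n                           ≡⟨ act-cong p (θ-^ₚ p k) n ⟩
    act p (λ i → fromℕ (suc k) ℚ.* act (xd p) (coeff (p ^ₚ k)) i) n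
      ≡⟨ act-scale p (fromℕ (suc k)) (act (xd p) (coeff (p ^ₚ k))) n ⟩
    fromℕ (suc k) ℚ.* act p (act (xd p) (coeff (p ^ₚ k))) n
      ≡⟨ cong (fromℕ (suc k) ℚ.*_) (trans (act-comm p (xd p) (coeff (p ^ₚ k)) n) (sym (act-cong (xd p) (coeff-*ₚ p (p ^ₚ k)) n))) ⟩
    fromℕ (suc k) ℚ.* act (xd p) (coeff (p ^ₚ suc k)) n           ∎

------------------------------------------------------------------------
-- Binomial coefficients and the binomial theorem

-- The binomial coefficient of a rational number over k: the value of binom.
bin : ℚ → ℕ → ℚ
bin x zero    = 1ℚ
bin x (suc k) = (+ 1 ℚ./ suc k) ℚ.* (bin x k ℚ.* (x ℚ.- fromℕ k))

bin-step : ∀ x k → fromℕ (suc k) ℚ.* bin x (suc k) ≡ bin x k ℚ.* (x ℚ.- fromℕ k)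
bin-step x k = begin
  fromℕ (suc k) ℚ.* ((+ 1 ℚ./ suc k) ℚ.* y)   ≡⟨ ℚₚ.*-assoc (fromℕ (suc k)) (+ 1 ℚ./ suc k) y ⟨
  fromℕ (suc k) ℚ.* (+ 1 ℚ./ suc k) ℚ.* y     ≡⟨ cong (ℚ._* y) (fromℕ-inverse k) ⟩
  1ℚ ℚ.* y                                 ≡⟨ ℚₚ.*-identityˡ y ⟩
  y                                        ∎
  where y = bin x k ℚ.* (x ℚ.- fromℕ k)

pascal : ∀ x k → bin (1ℚ ℚ.+ x) (suc k) ≡ bin x k ℚ.+ bin x (suc k)
pascal x zero    = solve 1 (λ x → con 1ℚ :* (con 1ℚ :* (con 1ℚ :+ x :- con 0ℚ)) := con 1ℚ :+ con 1ℚ :* (con 1ℚ :* (x :- con 0ℚ))) refl x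
pascal x (suc k) = fromℕ-suc-cancel (suc k) (begin
  fromℕ (suc (suc k)) ℚ.* bin (1ℚ ℚ.+ x) (suc (suc k))
    ≡⟨ bin-step (1ℚ ℚ.+ x) (suc k) ⟩
  bin (1ℚ ℚ.+ x) (suc k) ℚ.* (1ℚ ℚ.+ x ℚ.- fromℕ (suc k))
    ≡⟨ cong₂ (λ b f → b ℚ.* (1ℚ ℚ.+ x ℚ.- f)) (pascal x k) (fromℕ-suc k) ⟩
  (b₀ ℚ.+ b₁) ℚ.* (1ℚ ℚ.+ x ℚ.- (1ℚ ℚ.+ fromℕ k))
    ≡⟨ solve 4 (λ b₀ b₁ x k → (b₀ :+ b₁) :* (con 1ℚ :+ x :- (con 1ℚ :+ k)) := b₁ :* (x :- k) :+ b₀ :* (x :- k)) refl b₀ b₁ x (fromℕ k) ⟩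
  b₁ ℚ.* (x ℚ.- fromℕ k) ℚ.+ b₀ ℚ.* (x ℚ.- fromℕ k)
    ≡⟨ cong (b₁ ℚ.* (x ℚ.- fromℕ k) ℚ.+_) (trans (sym (bin-step x k)) (cong (ℚ._* b₁) (fromℕ-suc k))) ⟩
  b₁ ℚ.* (x ℚ.- fromℕ k) ℚ.+ (1ℚ ℚ.+ fromℕ k) ℚ.* b₁
    ≡⟨ solve 3 (λ b₁ x k → b₁ :* (x :- k) :+ (con 1ℚ :+ k) :* b₁ := (con 1ℚ :+ (con 1ℚ :+ k)) :* b₁ :+ b₁ :* (x :- (con 1ℚ :+ k))) refl b₁ x (fromℕ k) ⟩
  (1ℚ ℚ.+ (1ℚ ℚ.+ fromℕ k)) ℚ.* b₁ ℚ.+ b₁ ℚ.* (x ℚ.- (1ℚ ℚ.+ fromℕ k))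
    ≡⟨ cong (λ f → (1ℚ ℚ.+ f) ℚ.* b₁ ℚ.+ b₁ ℚ.* (x ℚ.- f)) (fromℕ-suc k) ⟨
  (1ℚ ℚ.+ fromℕ (suc k)) ℚ.* b₁ ℚ.+ b₁ ℚ.* (x ℚ.- fromℕ (suc k))
    ≡⟨ cong₂ ℚ._+_ (cong (ℚ._* b₁) (sym (fromℕ-suc (suc k)))) (sym (bin-step x (suc k))) ⟩
  fromℕ (suc (suc k)) ℚ.* b₁ ℚ.+ fromℕ (suc (suc k)) ℚ.* bin x (suc (suc k))
    ≡⟨ ℚₚ.*-distribˡ-+ (fromℕ (suc (suc k))) b₁ (bin x (suc (suc k))) ⟨
  fromℕ (suc (suc k)) ℚ.* (b₁ ℚ.+ bin x (suc (suc k))) ∎)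
  where
  b₀ = bin x k
  b₁ = bin x (suc k)

bin-suc-self : ∀ k → bin (fromℕ k) (suc k) ≡ 0ℚ
bin-suc-self k = trans (cong (λ z → (+ 1 ℚ./ suc k) ℚ.* (bin (fromℕ k) k ℚ.* z)) (ℚₚ.+-inverseʳ (fromℕ k)))
  (trans (cong ((+ 1 ℚ./ suc k) ℚ.*_) (ℚₚ.*-zeroʳ (bin (fromℕ k) k))) (ℚₚ.*-zeroʳ (+ 1 ℚ./ suc k)))

bin-zero : ∀ k → bin 0ℚ (suc k) ≡ 0ℚ
bin-zero zero    = refl
bin-zero (suc k) = trans (cong (λ z → (+ 1 ℚ./ suc (suc k)) ℚ.* (z ℚ.* (0ℚ ℚ.- fromℕ (suc k)))) (bin-zero k))
  (trans (cong ((+ 1 ℚ./ suc (suc k)) ℚ.*_) (ℚₚ.*-zeroˡ (0ℚ ℚ.- fromℕ (suc k)))) (ℚₚ.*-zeroʳ (+ 1 ℚ./ suc (suc k))))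

-- The coefficient of t^n in a product only sees the coefficients up to t^n.
act-local : ∀ p {g h} n → (∀ i → i ≤ n → g i ≡ h i) → act p g n ≡ act p h n
act-local []      n       eq = refl
act-local (a ∷ p) zero    eq = cong (λ z → a ℚ.* z ℚ.+ 0ℚ) (eq 0 z≤n)
act-local (a ∷ p) (suc n) eq =
  cong₂ (λ y z → a ℚ.* y ℚ.+ z) (eq (suc n) ℕₚ.≤-refl)
    (act-local p n λ i i≤n → eq i (ℕₚ.m≤n⇒m≤1+n i≤n))

act-const : ∀ a h n → act (const a) h n ≡ a ℚ.* h n
act-const a h zero    = ℚₚ.+-identityʳ (a ℚ.* h 0)
act-const a h (suc n) = ℚₚ.+-identityʳ (a ℚ.* h (suc n))

-- coeff (const 1ℚ) is the series 1.
act-one : ∀ p → act p (coeff (const 1ℚ)) ≗ coeff p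
act-one []      n       = refl
act-one (a ∷ p) zero    = trans (ℚₚ.+-identityʳ (a ℚ.* 1ℚ)) (ℚₚ.*-identityʳ a)
act-one (a ∷ p) (suc n) = trans (cong₂ ℚ._+_ (ℚₚ.*-zeroʳ a) (act-one p n)) (ℚₚ.+-identityˡ (coeff p n))

-- If t divides p and t^k divides h, then t^(k+1) divides p h.
act-raises-order : ∀ p h k → coeff p 0 ≡ 0ℚ → (∀ n → n < k → h n ≡ 0ℚ) → ∀ n → n < suc k → act p h n ≡ 0ℚ
act-raises-order []      h k eq low n       n<k       = refl
act-raises-order (a ∷ p) h k refl low zero    n<k       = trans (ℚₚ.+-identityʳ (0ℚ ℚ.* h 0)) (ℚₚ.*-zeroˡ (h 0))
act-raises-order (a ∷ p) h k refl low (suc n) (s≤s n<k) = trans (cong₂ ℚ._+_ (ℚₚ.*-zeroˡ (h (suc n)))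
  (trans (act-local p n (λ i i≤n → low i (ℕₚ.≤-<-trans i≤n n<k))) (act-0 p n))) refl

-- a 0 + a 1 + ... + a N, the rational counterpart of ∑≤.
sum≤ : ℕ → (ℕ → ℚ) → ℚ
sum≤ zero    a = a 0
sum≤ (suc N) a = sum≤ N a ℚ.+ a (suc N)

sum≤-cong : ∀ N {a b} → (∀ i → i ≤ N → a i ≡ b i) → sum≤ N a ≡ sum≤ N b
sum≤-cong zero    eq = eq 0 z≤n
sum≤-cong (suc N) eq = cong₂ ℚ._+_ (sum≤-cong N λ i i≤N → eq i (ℕₚ.m≤n⇒m≤1+n i≤N)) (eq (suc N) ℕₚ.≤-refl)

-- Pascal's rule summed up to N; the term with bin x N is the boundary term.
sum≤-pascal : ∀ x (a : ℕ → ℚ) N →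
  sum≤ N (λ k → bin (1ℚ ℚ.+ x) k ℚ.* a k) ℚ.+ bin x N ℚ.* a (suc N) ≡
  sum≤ N (λ k → bin x k ℚ.* a k) ℚ.+ sum≤ N (λ k → bin x k ℚ.* a (suc k))
sum≤-pascal x a zero    = refl
sum≤-pascal x a (suc N) = begin
  σ′ ℚ.+ bin (1ℚ ℚ.+ x) (suc N) ℚ.* a₁ ℚ.+ b₁ ℚ.* a₂
    ≡⟨ cong (λ b → σ′ ℚ.+ b ℚ.* a₁ ℚ.+ b₁ ℚ.* a₂) (pascal x N) ⟩
  σ′ ℚ.+ (b₀ ℚ.+ b₁) ℚ.* a₁ ℚ.+ b₁ ℚ.* a₂
    ≡⟨ solve 5 (λ s b₀ b₁ a₁ a₂ → s :+ (b₀ :+ b₁) :* a₁ :+ b₁ :* a₂ := (s :+ b₀ :* a₁) :+ (b₁ :* a₁ :+ b₁ :* a₂)) refl σ′ b₀ b₁ a₁ a₂ ⟩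
  (σ′ ℚ.+ b₀ ℚ.* a₁) ℚ.+ (b₁ ℚ.* a₁ ℚ.+ b₁ ℚ.* a₂)
    ≡⟨ cong (ℚ._+ (b₁ ℚ.* a₁ ℚ.+ b₁ ℚ.* a₂)) (sum≤-pascal x a N) ⟩
  (σ ℚ.+ τ) ℚ.+ (b₁ ℚ.* a₁ ℚ.+ b₁ ℚ.* a₂)
    ≡⟨ solve 4 (λ s t y z → (s :+ t) :+ (y :+ z) := (s :+ y) :+ (t :+ z)) refl σ τ (b₁ ℚ.* a₁) (b₁ ℚ.* a₂) ⟩
  (σ ℚ.+ b₁ ℚ.* a₁) ℚ.+ (τ ℚ.+ b₁ ℚ.* a₂) ∎
  where
  b₀ = bin x N
  b₁ = bin x (suc N)
  a₁ = a (suc N)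
  a₂ = a (suc (suc N))
  σ′ = sum≤ N λ k → bin (1ℚ ℚ.+ x) k ℚ.* a k
  σ  = sum≤ N λ k → bin x k ℚ.* a k
  τ  = sum≤ N λ k → bin x k ℚ.* a (suc k)

sum≤-bin-zero : ∀ (a : ℕ → ℚ) N → sum≤ N (λ k → bin 0ℚ k ℚ.* a k) ≡ a 0
sum≤-bin-zero a zero    = ℚₚ.*-identityˡ (a 0)
sum≤-bin-zero a (suc N) = trans (cong₂ ℚ._+_ (sum≤-bin-zero a N)
  (trans (cong (ℚ._* a (suc N)) (bin-zero N)) (ℚₚ.*-zeroˡ (a (suc N))))) (ℚₚ.+-identityʳ (a 0))

-- The binomial theorem for u^m = (1 + (u-1))^m, where
-- h k stands for (u-1)^k h 0, and the sum may stop at any N after which the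
-- coefficients of t^n vanish.
act-binomial : ∀ u (h : ℕ → Seq) → (∀ k → act u (h k) ≗ h k ⊕ h (suc k)) →
  ∀ m n N → (∀ k → N < k → h k n ≡ 0ℚ) →
  act (u ^ₚ m) (h 0) n ≡ sum≤ N λ k → bin (fromℕ m) k ℚ.* h k n
act-binomial u h step zero    n N vanish =
  trans (act-const 1ℚ (h 0) n) (trans (ℚₚ.*-identityˡ (h 0 n)) (sym (sum≤-bin-zero (λ k → h k n) N)))
act-binomial u h step (suc m) n N vanish = begin
  act (u *ₚ u ^ₚ m) (h 0) n                        ≡⟨ act-*ₚ u (u ^ₚ m) (h 0) n ⟩
  act u (act (u ^ₚ m) (h 0)) n                     ≡⟨ act-comm u (u ^ₚ m) (h 0) n ⟩
  act (u ^ₚ m) (act u (h 0)) n                     ≡⟨ act-cong (u ^ₚ m) (step 0) n ⟩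
  act (u ^ₚ m) (h 0 ⊕ h 1) n                       ≡⟨ act-⊕ (u ^ₚ m) (h 0) (h 1) n ⟩
  act (u ^ₚ m) (h 0) n ℚ.+ act (u ^ₚ m) (h 1) n
    ≡⟨ cong₂ ℚ._+_ (act-binomial u h step m n N vanish)
         (act-binomial u (h ∘ suc) (step ∘ suc) m n N (λ k N<k → vanish (suc k) (ℕₚ.m≤n⇒m≤1+n N<k))) ⟩
  sum≤ N (λ k → bin (fromℕ m) k ℚ.* h k n) ℚ.+ sum≤ N (λ k → bin (fromℕ m) k ℚ.* h (suc k) n)
    ≡⟨ sum≤-pascal (fromℕ m) (λ k → h k n) N ⟨
  sum≤ N (λ k → bin (1ℚ ℚ.+ fromℕ m) k ℚ.* h k n) ℚ.+ bin (fromℕ m) N ℚ.* h (suc N) n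
    ≡⟨ cong₂ (λ y z → sum≤ N (λ k → bin y k ℚ.* h k n) ℚ.+ bin (fromℕ m) N ℚ.* z) (sym (fromℕ-suc m)) (vanish (suc N) ℕₚ.≤-refl) ⟩
  σ ℚ.+ bin (fromℕ m) N ℚ.* 0ℚ                        ≡⟨ cong (σ ℚ.+_) (ℚₚ.*-zeroʳ (bin (fromℕ m) N)) ⟩
  σ ℚ.+ 0ℚ                                         ≡⟨ ℚₚ.+-identityʳ σ ⟩
  σ                                                ∎
  where σ = sum≤ N λ k → bin (fromℕ (suc m)) k ℚ.* h k n

-- If f has constant term 1 then (f-1)^k is divisible by t^k, so that the
-- expansion of f^m in powers of f-1 stops at k = n.
^ₚ-expansion : ∀ f → coeff (f -ₚ const 1ℚ) 0 ≡ 0ℚ → ∀ m n →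
  coeff (f ^ₚ m) n ≡ sum≤ n λ k → bin (fromℕ m) k ℚ.* coeff ((f -ₚ const 1ℚ) ^ₚ k) n
^ₚ-expansion f g₀ m n = trans (sym (act-one (f ^ₚ m) n))
  (act-binomial f h step m n n λ k n<k → vanish k n n<k)
  where
  g = f -ₚ const 1ℚ
  h : ℕ → Seq
  h k = coeff (g ^ₚ k)
  step : ∀ k → act f (h k) ≗ h k ⊕ h (suc k)
  step k i = begin
    y                                               ≡⟨ solve 2 (λ x y → y := x :+ (y :+ con (- 1ℚ) :* con 1ℚ :* x)) refl x y ⟩
    x ℚ.+ (y ℚ.+ (- 1ℚ) ℚ.* 1ℚ ℚ.* x)               ≡⟨ cong (λ z → x ℚ.+ (y ℚ.+ z)) (act-const ((- 1ℚ) ℚ.* 1ℚ) (h k) i) ⟨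
    x ℚ.+ (y ℚ.+ act ((- 1ℚ) ·ₚ const 1ℚ) (h k) i)  ≡⟨ cong (x ℚ.+_) (act-+ₚ f ((- 1ℚ) ·ₚ const 1ℚ) (h k) i) ⟨
    x ℚ.+ act g (h k) i                             ≡⟨ cong (x ℚ.+_) (coeff-*ₚ g (g ^ₚ k) i) ⟨
    x ℚ.+ h (suc k) i                               ∎
    where
    x = h k i
    y = act f (h k) i
  vanish : ∀ k i → i < k → h k i ≡ 0ℚ
  vanish (suc k) i i<k = trans (coeff-*ₚ g (g ^ₚ k) i) (act-raises-order g (h k) k g₀ (vanish k) i i<k)

------------------------------------------------------------------------
-- The powers of 1 + t + ... + t^(r-1)

-- Multiplication by t^k.
shifts : ℕ → Seq → Seq
shifts zero    h = h
shifts (suc k) h = shift (shifts k h)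

shifts-+ : ∀ a b h → shifts (a + b) h ≗ shifts a (shifts b h)
shifts-+ zero    b h n = refl
shifts-+ (suc a) b h n = shift-cong (shifts-+ a b h) n

shifts-≤ : ∀ k h {n} → k ≤ n → shifts k h n ≡ h (n ∸ k)
shifts-≤ zero    h         k≤n       = refl
shifts-≤ (suc k) h {suc n} (s≤s k≤n) = shifts-≤ k h k≤n

shifts-> : ∀ k h {n} → n < k → shifts k h n ≡ 0ℚ
shifts-> (suc k) h {zero}  n<k       = refl
shifts-> (suc k) h {suc n} (s≤s n<k) = shifts-> k h n<k

-- 1 + t + ... + t^(r-1).
ones : ℕ → Poly
ones r = replicate r 1ℚ

1-t : Poly
1-t = 1ℚ ∷ - 1ℚ ∷ []

act-1-t : ∀ h n → act 1-t h n ≡ h n ℚ.- shift h n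
act-1-t h zero    = cong (ℚ._+ 0ℚ) (ℚₚ.*-identityˡ (h 0))
act-1-t h (suc n) = trans (cong (1ℚ ℚ.* h (suc n) ℚ.+_) (act-const (- 1ℚ) h n))
  (solve 2 (λ x y → con 1ℚ :* x :+ con (- 1ℚ) :* y := x :- y) refl (h (suc n)) (h n))

act-1-t-ones : ∀ r h n → act 1-t (act (ones r) h) n ≡ h n ℚ.- shifts r h n
act-1-t-ones zero    h n = trans (act-0 1-t n) (sym (ℚₚ.+-inverseʳ (h n)))
act-1-t-ones (suc r) h n = begin
  act 1-t (act (ones (suc r)) h) n                        ≡⟨ act-⊕ 1-t (λ i → 1ℚ ℚ.* h i) (shift w) n ⟩
  act 1-t (λ i → 1ℚ ℚ.* h i) n ℚ.+ act 1-t (shift w) n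
    ≡⟨ cong₂ ℚ._+_ (trans (act-cong 1-t (ℚₚ.*-identityˡ ∘ h) n) (act-1-t h n))
                   (trans (act-shift 1-t w n) (shift-cong (act-1-t-ones r h) n)) ⟩
  (h n ℚ.- shift h n) ℚ.+ shift (λ i → h i ℚ.- shifts r h i) n
    ≡⟨ telescope n ⟩
  h n ℚ.- shift (shifts r h) n                            ∎
  where
  w = act (ones r) h
  telescope : ∀ n → (h n ℚ.- shift h n) ℚ.+ shift (λ i → h i ℚ.- shifts r h i) n ≡ h n ℚ.- shift (shifts r h) n
  telescope zero    = ℚₚ.+-identityʳ (h 0 ℚ.- 0ℚ)
  telescope (suc n) = solve 3 (λ x y z → (x :- y) :+ (y :- z) := x :- z) refl (h (suc n)) (h n) (shifts r h n)

-- The series (1-t)^(-l).  The exponent 0 is a separate case because the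
-- coefficients of (1-t)^(-l-1) are the binomials of l+n over n.
geom : ℕ → Seq
geom zero    n = coeff (const 1ℚ) n
geom (suc l) n = bin (fromℕ (l + n)) n

act-1-t-geom : ∀ l → act 1-t (geom (suc l)) ≗ geom l
act-1-t-geom l n = trans (act-1-t (geom (suc l)) n) (diff l n)
  where
  drop : ∀ k n → bin (fromℕ (suc k)) (suc n) ℚ.- bin (fromℕ k) n ≡ bin (fromℕ k) (suc n)
  drop k n = begin
    bin (fromℕ (suc k)) (suc n) ℚ.- bin (fromℕ k) n                    ≡⟨ cong (λ y → bin y (suc n) ℚ.- bin (fromℕ k) n) (fromℕ-suc k) ⟩
    bin (1ℚ ℚ.+ fromℕ k) (suc n) ℚ.- bin (fromℕ k) n                   ≡⟨ cong (ℚ._- bin (fromℕ k) n) (pascal (fromℕ k) n) ⟩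
    bin (fromℕ k) n ℚ.+ bin (fromℕ k) (suc n) ℚ.- bin (fromℕ k) n
      ≡⟨ solve 2 (λ x y → x :+ y :- x := y) refl (bin (fromℕ k) n) (bin (fromℕ k) (suc n)) ⟩
    bin (fromℕ k) (suc n)                                           ∎
  diff : ∀ l n → geom (suc l) n ℚ.- shift (geom (suc l)) n ≡ geom l n
  diff zero    zero    = refl
  diff (suc l) zero    = refl
  diff zero    (suc n) = trans (drop n n) (bin-suc-self n)
  diff (suc l) (suc n) = begin
    bin (fromℕ (suc (l + suc n))) (suc n) ℚ.- bin (fromℕ (suc (l + n))) n
      ≡⟨ cong (λ k → bin (fromℕ (suc (l + suc n))) (suc n) ℚ.- bin (fromℕ k) n) (ℕₚ.+-suc l n) ⟨
    bin (fromℕ (suc (l + suc n))) (suc n) ℚ.- bin (fromℕ (l + suc n)) n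
      ≡⟨ drop (l + suc n) n ⟩
    bin (fromℕ (l + suc n)) (suc n) ∎

module _ (r : ℕ) where
  -- 1 - t^r, written as a product so that its powers involve those of ones r.
  1-tʳ : Poly
  1-tʳ = 1-t *ₚ ones r

  act-1-tʳ : ∀ h n → act 1-tʳ h n ≡ h n ℚ.- shifts r h n
  act-1-tʳ h n = trans (act-*ₚ 1-t (ones r) h n) (act-1-t-ones r h n)

  -- f^m = (1-t^r)^m (1-t)^(-m).
  ones-^ₚ : ∀ m → act (1-tʳ ^ₚ m) (geom m) ≗ coeff (ones r ^ₚ m)
  ones-^ₚ zero    n = act-one (const 1ℚ) n
  ones-^ₚ (suc m) n = begin
    act (1-tʳ *ₚ 1-tʳ ^ₚ m) (geom (suc m)) n         ≡⟨ act-*ₚ 1-tʳ (1-tʳ ^ₚ m) (geom (suc m)) n ⟩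
    act 1-tʳ (act (1-tʳ ^ₚ m) (geom (suc m))) n      ≡⟨ act-comm 1-tʳ (1-tʳ ^ₚ m) (geom (suc m)) n ⟩
    act (1-tʳ ^ₚ m) (act 1-tʳ (geom (suc m))) n      ≡⟨ act-cong (1-tʳ ^ₚ m) lower n ⟩
    act (1-tʳ ^ₚ m) (act (ones r) (geom m)) n        ≡⟨ act-comm (1-tʳ ^ₚ m) (ones r) (geom m) n ⟩
    act (ones r) (act (1-tʳ ^ₚ m) (geom m)) n        ≡⟨ act-cong (ones r) (ones-^ₚ m) n ⟩
    act (ones r) (coeff (ones r ^ₚ m)) n             ≡⟨ coeff-*ₚ (ones r) (ones r ^ₚ m) n ⟨
    coeff (ones r ^ₚ suc m) n                        ∎
    where
    lower : act 1-tʳ (geom (suc m)) ≗ act (ones r) (geom m)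
    lower i = begin
      act 1-tʳ (geom (suc m)) i                      ≡⟨ act-*ₚ 1-t (ones r) (geom (suc m)) i ⟩
      act 1-t (act (ones r) (geom (suc m))) i        ≡⟨ act-comm 1-t (ones r) (geom (suc m)) i ⟩
      act (ones r) (act 1-t (geom (suc m))) i        ≡⟨ act-cong (ones r) (act-1-t-geom m) i ⟩
      act (ones r) (geom m) i                        ∎

-- (-1)^i.
sign : ℕ → ℚ
sign zero    = 1ℚ
sign (suc i) = (- 1ℚ) ℚ.* sign i

-- The terms with r i > n vanish, so that the sum stops at the quotient n / r.
ones-^ₚ-explicit : ∀ r .{{_ : NonZero r}} m n →
  coeff (ones r ^ₚ suc m) n ≡
  sum≤ (n / r) λ i → sign i ℚ.* bin (fromℕ (suc m)) i ℚ.* bin (fromℕ m ℚ.+ fromℕ (n ∸ r * i)) (n ∸ r * i)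
ones-^ₚ-explicit r m n = begin
  coeff (ones r ^ₚ suc m) n                        ≡⟨ ones-^ₚ r (suc m) n ⟨
  act (1-tʳ r ^ₚ suc m) (geom (suc m)) n           ≡⟨ act-cong (1-tʳ r ^ₚ suc m) h₀ n ⟨
  act (1-tʳ r ^ₚ suc m) (h 0) n                    ≡⟨ act-binomial (1-tʳ r) h step (suc m) n (n / r) vanish ⟩
  sum≤ (n / r) (λ k → bin (fromℕ (suc m)) k ℚ.* h k n)
    ≡⟨ sum≤-cong (n / r) term ⟩
  sum≤ (n / r) (λ i → sign i ℚ.* bin (fromℕ (suc m)) i ℚ.* bin (fromℕ m ℚ.+ fromℕ (n ∸ r * i)) (n ∸ r * i)) ∎
  where
  -- h k = (-t^r)^k (1-t)^(-m-1), where -t^r is 1-tʳ minus 1.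
  h : ℕ → Seq
  h k i = sign k ℚ.* shifts (r * k) (geom (suc m)) i
  h₀ : h 0 ≗ geom (suc m)
  h₀ i = trans (ℚₚ.*-identityˡ (shifts (r * 0) (geom (suc m)) i)) (cong (λ z → shifts z (geom (suc m)) i) (ℕₚ.*-zeroʳ r))
  step : ∀ k → act (1-tʳ r) (h k) ≗ h k ⊕ h (suc k)
  step k i = begin
    act (1-tʳ r) (h k) i                       ≡⟨ act-scale (1-tʳ r) (sign k) y i ⟩
    sign k ℚ.* act (1-tʳ r) y i                ≡⟨ cong (sign k ℚ.*_) (act-1-tʳ r y i) ⟩
    sign k ℚ.* (y i ℚ.- shifts r y i)          ≡⟨ cong (λ z → sign k ℚ.* (y i ℚ.- z)) (shifts-+ r (r * k) (geom (suc m)) i) ⟨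
    sign k ℚ.* (y i ℚ.- shifts (r + r * k) (geom (suc m)) i)
      ≡⟨ cong (λ z → sign k ℚ.* (y i ℚ.- shifts z (geom (suc m)) i)) (ℕₚ.*-suc r k) ⟨
    sign k ℚ.* (y i ℚ.- shifts (r * suc k) (geom (suc m)) i)
      ≡⟨ solve 3 (λ s y z → s :* (y :- z) := s :* y :+ con (- 1ℚ) :* s :* z) refl (sign k) (y i) (shifts (r * suc k) (geom (suc m)) i) ⟩
    h k i ℚ.+ h (suc k) i                      ∎
    where y = shifts (r * k) (geom (suc m))
  vanish : ∀ k → n / r < k → h k n ≡ 0ℚ
  vanish k n/r<k = trans (cong (sign k ℚ.*_) (shifts-> (r * k) (geom (suc m)) n<r*k)) (ℚₚ.*-zeroʳ (sign k))
    where
    n<r*k : n < r * k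
    n<r*k = ℕₚ.≰⇒> λ r*k≤n → ℕₚ.<⇒≱ n/r<k
      (subst (_≤ n / r) (trans (cong (_/ r) (ℕₚ.*-comm r k)) (DivMod.m*n/n≡m k r)) (DivMod./-monoˡ-≤ r r*k≤n))
  term : ∀ i → i ≤ n / r → bin (fromℕ (suc m)) i ℚ.* h i n ≡
         sign i ℚ.* bin (fromℕ (suc m)) i ℚ.* bin (fromℕ m ℚ.+ fromℕ (n ∸ r * i)) (n ∸ r * i)
  term i i≤n/r = begin
    b ℚ.* (sign i ℚ.* shifts (r * i) (geom (suc m)) n)     ≡⟨ cong (λ z → b ℚ.* (sign i ℚ.* z)) (shifts-≤ (r * i) (geom (suc m)) r*i≤n) ⟩
    b ℚ.* (sign i ℚ.* bin (fromℕ (m + j)) j)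
      ≡⟨ solve 3 (λ b s c → b :* (s :* c) := s :* b :* c) refl b (sign i) (bin (fromℕ (m + j)) j) ⟩
    sign i ℚ.* b ℚ.* bin (fromℕ (m + j)) j                    ≡⟨ cong (λ z → sign i ℚ.* b ℚ.* bin z j) (fromℕ-+ m j) ⟩
    sign i ℚ.* b ℚ.* bin (fromℕ m ℚ.+ fromℕ j) j                 ∎
    where
    b = bin (fromℕ (suc m)) i
    j = n ∸ r * i
    r*i≤n : r * i ≤ n
    r*i≤n = ℕₚ.≤-trans (ℕₚ.*-monoʳ-≤ r i≤n/r) (subst (_≤ n) (ℕₚ.*-comm (n / r) r) (DivMod.m/n*n≤m n r))

------------------------------------------------------------------------
-- Evaluation of polynomials

eval-+ₚ : ∀ p q x → eval (p +ₚ q) x ≡ eval p x ℚ.+ eval q x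
eval-+ₚ []      q       x = sym (ℚₚ.+-identityˡ (eval q x))
eval-+ₚ (a ∷ p) []      x = sym (ℚₚ.+-identityʳ (eval (a ∷ p) x))
eval-+ₚ (a ∷ p) (b ∷ q) x = trans (cong (λ z → a ℚ.+ b ℚ.+ x ℚ.* z) (eval-+ₚ p q x))
  (solve 5 (λ a b x y z → a :+ b :+ x :* (y :+ z) := (a :+ x :* y) :+ (b :+ x :* z)) refl a b x (eval p x) (eval q x))

eval-·ₚ : ∀ a p x → eval (a ·ₚ p) x ≡ a ℚ.* eval p x
eval-·ₚ a []      x = sym (ℚₚ.*-zeroʳ a)
eval-·ₚ a (b ∷ p) x = trans (cong (λ z → a ℚ.* b ℚ.+ x ℚ.* z) (eval-·ₚ a p x))
  (solve 4 (λ a b x y → a :* b :+ x :* (a :* y) := a :* (b :+ x :* y)) refl a b x (eval p x))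

eval--ₚ : ∀ p q x → eval (p -ₚ q) x ≡ eval p x ℚ.- eval q x
eval--ₚ p q x = trans (eval-+ₚ p ((- 1ℚ) ·ₚ q) x) (trans (cong (eval p x ℚ.+_) (eval-·ₚ (- 1ℚ) q x))
  (solve 2 (λ y z → y :+ con (- 1ℚ) :* z := y :- z) refl (eval p x) (eval q x)))

eval-*ₚ : ∀ p q x → eval (p *ₚ q) x ≡ eval p x ℚ.* eval q x
eval-*ₚ []      q x = sym (ℚₚ.*-zeroˡ (eval q x))
eval-*ₚ (a ∷ p) q x = begin
  eval (a ·ₚ q +ₚ (0ℚ ∷ (p *ₚ q))) x                     ≡⟨ eval-+ₚ (a ·ₚ q) (0ℚ ∷ (p *ₚ q)) x ⟩
  eval (a ·ₚ q) x ℚ.+ (0ℚ ℚ.+ x ℚ.* eval (p *ₚ q) x)     ≡⟨ cong₂ (λ y z → y ℚ.+ (0ℚ ℚ.+ x ℚ.* z)) (eval-·ₚ a q x) (eval-*ₚ p q x) ⟩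
  a ℚ.* eval q x ℚ.+ (0ℚ ℚ.+ x ℚ.* (eval p x ℚ.* eval q x))
    ≡⟨ solve 4 (λ a x y z → a :* z :+ (con 0ℚ :+ x :* (y :* z)) := (a :+ x :* y) :* z) refl a x (eval p x) (eval q x) ⟩
  (a ℚ.+ x ℚ.* eval p x) ℚ.* eval q x                    ∎

eval-const : ∀ a x → eval (const a) x ≡ a
eval-const a x = trans (cong (a ℚ.+_) (ℚₚ.*-zeroʳ x)) (ℚₚ.+-identityʳ a)

eval-X : ∀ x → eval X x ≡ x
eval-X x = solve 1 (λ x → con 0ℚ :+ x :* (con 1ℚ :+ x :* con 0ℚ) := x) refl x

eval-X+nat : ∀ k x → eval (X +ₚ nat k) x ≡ x ℚ.+ fromℕ k
eval-X+nat k x = trans (eval-+ₚ X (nat k) x) (cong₂ ℚ._+_ (eval-X x) (eval-const (fromℕ k) x))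

eval-X+1 : ∀ m → eval (X +ₚ nat 1) (fromℕ m) ≡ fromℕ (suc m)
eval-X+1 m = trans (eval-X+nat 1 (fromℕ m)) (trans (ℚₚ.+-comm (fromℕ m) 1ℚ) (sym (fromℕ-suc m)))

eval-∑≤ : ∀ N f x → eval (∑≤ N f) x ≡ sum≤ N λ i → eval (f i) x
eval-∑≤ zero    f x = refl
eval-∑≤ (suc N) f x = trans (eval-+ₚ (∑≤ N f) (f (suc N)) x) (cong (ℚ._+ eval (f (suc N)) x) (eval-∑≤ N f x))

eval-binom : ∀ p k x → eval (binom p k) x ≡ bin (eval p x) k
eval-binom p zero    x = eval-const 1ℚ x
eval-binom p (suc k) x = trans (eval-·ₚ c (binom p k *ₚ (p -ₚ nat k)) x) (cong (c ℚ.*_)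
  (trans (eval-*ₚ (binom p k) (p -ₚ nat k) x) (cong₂ ℚ._*_ (eval-binom p k x)
    (trans (eval--ₚ p (nat k) x) (cong (λ z → eval p x ℚ.- z) (eval-const (fromℕ k) x))))))
  where c = + 1 ℚ./ suc k

eval-sign : ∀ i x → eval (const (- 1ℚ) ^ₚ i) x ≡ sign i
eval-sign zero    x = eval-const 1ℚ x
eval-sign (suc i) x = trans (eval-*ₚ (const (- 1ℚ)) (const (- 1ℚ) ^ₚ i) x) (cong₂ ℚ._*_ (eval-const (- 1ℚ) x) (eval-sign i x))

------------------------------------------------------------------------
-- Polynomials are determined by their values

eval-zero : ∀ p x → p ≈ₚ [] → eval p x ≡ 0ℚ
eval-zero []      x eq = refl
eval-zero (a ∷ p) x eq = trans (cong₂ (λ y z → y ℚ.+ x ℚ.* z) (eq 0) (eval-zero p x (eq ∘ suc)))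
  (trans (ℚₚ.+-identityˡ (x ℚ.* 0ℚ)) (ℚₚ.*-zeroʳ x))

-- Synthetic division: quot a p is the quotient of (c + x p(x)) - (c + a p(a)) by
-- x - a; it does not depend on the constant c.
quot : ℚ → Poly → Poly
quot a []      = []
quot a (c ∷ p) = eval (c ∷ p) a ∷ quot a p

length-quot : ∀ a p → length (quot a p) ≡ length p
length-quot a []      = refl
length-quot a (c ∷ p) = cong suc (length-quot a p)

eval-quot : ∀ a c p x → eval (c ∷ p) x ℚ.- eval (c ∷ p) a ≡ (x ℚ.- a) ℚ.* eval (quot a p) x
eval-quot a c []      x = solve 3 (λ a c x → (c :+ x :* con 0ℚ) :- (c :+ a :* con 0ℚ) := (x :- a) :* con 0ℚ) refl a c x
eval-quot a c (d ∷ p) x = begin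
  (c ℚ.+ x ℚ.* u) ℚ.- (c ℚ.+ a ℚ.* v)
    ≡⟨ solve 5 (λ a c x u v → (c :+ x :* u) :- (c :+ a :* v) := (x :- a) :* v :+ x :* (u :- v)) refl a c x u v ⟩
  (x ℚ.- a) ℚ.* v ℚ.+ x ℚ.* (u ℚ.- v)                           ≡⟨ cong (λ z → (x ℚ.- a) ℚ.* v ℚ.+ x ℚ.* z) (eval-quot a d p x) ⟩
  (x ℚ.- a) ℚ.* v ℚ.+ x ℚ.* ((x ℚ.- a) ℚ.* eval (quot a p) x)
    ≡⟨ solve 4 (λ a x v w → (x :- a) :* v :+ x :* ((x :- a) :* w) := (x :- a) :* (v :+ x :* w)) refl a x v (eval (quot a p) x) ⟩
  (x ℚ.- a) ℚ.* (v ℚ.+ x ℚ.* eval (quot a p) x)                 ∎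
  where
  u = eval (d ∷ p) x
  v = eval (d ∷ p) a

-- The coefficients of the quotient are the values at a of the tails of p, and
-- a polynomial is recovered from the values at a of its tails.
quot-zero : ∀ a p → quot a p ≈ₚ [] → p ≈ₚ []
quot-zero a []      eq k       = refl
quot-zero a (c ∷ p) eq (suc k) = quot-zero a p (eq ∘ suc) k
quot-zero a (c ∷ p) eq zero    = begin
  c                        ≡⟨ ℚₚ.+-identityʳ c ⟨
  c ℚ.+ 0ℚ                 ≡⟨ cong (c ℚ.+_) (trans (cong (a ℚ.*_) (eval-zero p a (quot-zero a p (eq ∘ suc)))) (ℚₚ.*-zeroʳ a)) ⟨
  c ℚ.+ a ℚ.* eval p a     ≡⟨ eq 0 ⟩
  0ℚ                       ∎

-- A polynomial vanishing at all naturals from N on is zero: dividing by x - N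
-- lowers the length and leaves a polynomial vanishing from N+1 on.
roots-zero : ∀ ℓ p → length p ≡ ℓ → ∀ N → (∀ m → N ≤ m → eval p (fromℕ m) ≡ 0ℚ) → p ≈ₚ []
roots-zero ℓ       []      len N root k = refl
roots-zero (suc ℓ) (c ∷ p) len N root = λ { zero → c≡0 ; (suc k) → p≈0 k }
  where
  a = fromℕ N
  q≈0 : quot a p ≈ₚ []
  q≈0 = roots-zero ℓ (quot a p) (trans (length-quot a p) (ℕₚ.suc-injective len)) (suc N) λ m N<m → quotient-root m N<m
    where
    quotient-root : ∀ m → N < m → eval (quot a p) (fromℕ m) ≡ 0ℚ
    quotient-root m N<m = fromℕ-suc-cancel j (begin
      fromℕ (suc j) ℚ.* z                                   ≡⟨ cong (ℚ._* z) m-N ⟨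
      (fromℕ m ℚ.- a) ℚ.* z                                 ≡⟨ eval-quot a c p (fromℕ m) ⟨
      eval (c ∷ p) (fromℕ m) ℚ.- eval (c ∷ p) a             ≡⟨ cong₂ ℚ._-_ (root m (ℕₚ.<⇒≤ N<m)) (root N ℕₚ.≤-refl) ⟩
      0ℚ                                                 ≡⟨ ℚₚ.*-zeroʳ (fromℕ (suc j)) ⟨
      fromℕ (suc j) ℚ.* 0ℚ                                  ∎)
      where
      z = eval (quot a p) (fromℕ m)
      j = m ∸ suc N
      m-N : fromℕ m ℚ.- a ≡ fromℕ (suc j)
      m-N = begin
        fromℕ m ℚ.- a                      ≡⟨ cong (λ i → fromℕ i ℚ.- a) (trans (sym (ℕₚ.m+[n∸m]≡n N<m)) (sym (ℕₚ.+-suc N j))) ⟩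
        fromℕ (N + suc j) ℚ.- a            ≡⟨ cong (ℚ._- a) (fromℕ-+ N (suc j)) ⟩
        a ℚ.+ fromℕ (suc j) ℚ.- a          ≡⟨ solve 2 (λ a b → a :+ b :- a := b) refl a (fromℕ (suc j)) ⟩
        fromℕ (suc j)                      ∎
  p≈0 : p ≈ₚ []
  p≈0 = quot-zero a p q≈0
  c≡0 : c ≡ 0ℚ
  c≡0 = begin
    c                        ≡⟨ ℚₚ.+-identityʳ c ⟨
    c ℚ.+ 0ℚ                 ≡⟨ cong (c ℚ.+_) (trans (cong (a ℚ.*_) (eval-zero p a p≈0)) (ℚₚ.*-zeroʳ a)) ⟨
    eval (c ∷ p) a           ≡⟨ root N ℕₚ.≤-refl ⟩
    0ℚ                       ∎

identity-theorem : ∀ p q N → (∀ m → N ≤ m → eval p (fromℕ m) ≡ eval q (fromℕ m)) → p ≈ₚ q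
identity-theorem p q N eq k = begin
  coeff p k                             ≡⟨ solve 2 (λ x y → x := y :+ (x :+ con (- 1ℚ) :* y)) refl (coeff p k) (coeff q k) ⟩
  coeff q k ℚ.+ (coeff p k ℚ.+ (- 1ℚ) ℚ.* coeff q k)
    ≡⟨ cong (coeff q k ℚ.+_) (trans (coeff-+ₚ p ((- 1ℚ) ·ₚ q) k) (cong (coeff p k ℚ.+_) (coeff-·ₚ (- 1ℚ) q k))) ⟨
  coeff q k ℚ.+ coeff (p -ₚ q) k        ≡⟨ cong (coeff q k ℚ.+_) (roots-zero (length (p -ₚ q)) (p -ₚ q) refl N difference k) ⟩
  coeff q k ℚ.+ 0ℚ                      ≡⟨ ℚₚ.+-identityʳ (coeff q k) ⟩
  coeff q k                             ∎
  where
  difference : ∀ m → N ≤ m → eval (p -ₚ q) (fromℕ m) ≡ 0ℚ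
  difference m N≤m = begin
    eval (p -ₚ q) (fromℕ m)                   ≡⟨ eval--ₚ p q (fromℕ m) ⟩
    eval p (fromℕ m) ℚ.- eval q (fromℕ m)        ≡⟨ cong (ℚ._- eval q (fromℕ m)) (eq m N≤m) ⟩
    eval q (fromℕ m) ℚ.- eval q (fromℕ m)        ≡⟨ ℚₚ.+-inverseʳ (eval q (fromℕ m)) ⟩
    0ℚ                                     ∎

------------------------------------------------------------------------
-- Counting words by their last letter

private variable
  A : Set
  P Q : A → Set

-- The number of entries of a list that satisfy the predicate.
count : {P : A → Set} → Decidable P → List A → ℕ
count P? ws = length (filter P? ws)

count-++ : (P? : Decidable P) → ∀ vs ws → count P? (vs ++ ws) ≡ count P? vs + count P? ws
count-++ P? vs ws = trans (cong length (Listₚ.filter-++ P? vs ws)) (Listₚ.length-++ (filter P? vs))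

count-map : {P : A → Set} (P? : Decidable P) (f : A → A) → ∀ ws → count P? (map f ws) ≡ count (P? ∘ f) ws
count-map P? f []       = refl
count-map P? f (w ∷ ws) with P? (f w)
... | yes _ = cong suc (count-map P? f ws)
... | no  _ = count-map P? f ws

count-≐ : (P? : Decidable P) (Q? : Decidable Q) → P ≐ Q → ∀ ws → count P? ws ≡ count Q? ws
count-≐ P? Q? P≐Q ws = cong length (Listₚ.filter-≐ P? Q? P≐Q ws)

count-none : (P? : Decidable P) → (∀ w → ¬ P w) → ∀ ws → count P? ws ≡ 0
count-none P? ¬P ws = cong length (Listₚ.filter-none P? (All.universal ¬P ws))

count-cons : {P : List Step → Set} (P? : Decidable P) → ∀ k →
  count P? (words (suc k)) ≡ count (P? ∘ (up ∷_)) (words k) + count (P? ∘ (right ∷_)) (words k)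
count-cons P? k = trans (count-++ P? (map (up ∷_) (words k)) (map (right ∷_) (words k)))
  (cong₂ _+_ (count-map P? (up ∷_) (words k)) (count-map P? (right ∷_) (words k)))

-- words lists the words by their first letter; as a multiset the list is the
-- same when they are built from their last letter.
count-snoc : {P : List Step → Set} (P? : Decidable P) → ∀ k →
  count P? (words (suc k)) ≡ count (P? ∘ (_∷ʳ up)) (words k) + count (P? ∘ (_∷ʳ right)) (words k)
count-snoc P? zero    = trans (count-++ P? ((up ∷ []) ∷ []) ((right ∷ []) ∷ []))
  (cong₂ _+_ (count-map P? (_∷ʳ up) ([] ∷ [])) (count-map P? (_∷ʳ right) ([] ∷ [])))
count-snoc P? (suc k) = begin
  count P? (words (suc (suc k)))
    ≡⟨ count-cons P? (suc k) ⟩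
  count (P? ∘ (up ∷_)) (words (suc k)) + count (P? ∘ (right ∷_)) (words (suc k))
    ≡⟨ cong₂ _+_ (count-snoc (P? ∘ (up ∷_)) k) (count-snoc (P? ∘ (right ∷_)) k) ⟩
  (uu + ur) + (ru + rr)
    ≡⟨ interchange uu ur ru rr ⟩
  (uu + ru) + (ur + rr)
    ≡⟨ cong₂ _+_ (count-cons (P? ∘ (_∷ʳ up)) k) (count-cons (P? ∘ (_∷ʳ right)) k) ⟨
  count (P? ∘ (_∷ʳ up)) (words (suc k)) + count (P? ∘ (_∷ʳ right)) (words (suc k)) ∎
  where
  uu = count (P? ∘ (up ∷_) ∘ (_∷ʳ up)) (words k)
  ur = count (P? ∘ (up ∷_) ∘ (_∷ʳ right)) (words k)
  ru = count (P? ∘ (right ∷_) ∘ (_∷ʳ up)) (words k)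
  rr = count (P? ∘ (right ∷_) ∘ (_∷ʳ right)) (words k)

------------------------------------------------------------------------
-- Effect of a last step on a path

#-∷ʳ : ∀ a w b → # a ∈ (w ∷ʳ b) ≡ # a ∈ w + # a ∈ (b ∷ [])
#-∷ʳ a w b = count-++ (a ≟ˢ_) w (b ∷ [])

#right-up : ∀ w → # right ∈ (w ∷ʳ up) ≡ # right ∈ w
#right-up w = trans (#-∷ʳ right w up) (ℕₚ.+-identityʳ _)

#up-right : ∀ w → # up ∈ (w ∷ʳ right) ≡ # up ∈ w
#up-right w = trans (#-∷ʳ up w right) (ℕₚ.+-identityʳ _)

#up-up : ∀ w → # up ∈ (w ∷ʳ up) ≡ suc (# up ∈ w)
#up-up w = trans (#-∷ʳ up w up) (ℕₚ.+-comm _ 1)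

#right-right : ∀ w → # right ∈ (w ∷ʳ right) ≡ suc (# right ∈ w)
#right-right w = trans (#-∷ʳ right w right) (ℕₚ.+-comm _ 1)

inits-∷ʳ⁺ : {P : List A → Set} → ∀ w x → All P (inits w) → P (w ∷ʳ x) → All P (inits (w ∷ʳ x))
inits-∷ʳ⁺ []      x (p ∷ []) q = p ∷ q ∷ []
inits-∷ʳ⁺ (y ∷ w) x (p ∷ ps) q = p ∷ Allₚ.map⁺ (inits-∷ʳ⁺ w x (Allₚ.map⁻ ps) q)

inits-∷ʳ⁻ : {P : List A → Set} → ∀ w x → All P (inits (w ∷ʳ x)) → All P (inits w) × P (w ∷ʳ x)
inits-∷ʳ⁻ []      x (p ∷ q ∷ []) = p ∷ [] , q
inits-∷ʳ⁻ (y ∷ w) x (p ∷ ps) with inits-∷ʳ⁻ w x (Allₚ.map⁻ ps)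
... | qs , q = p ∷ Allₚ.map⁺ qs , q

inits-last : {P : List A → Set} → ∀ w → All P (inits w) → P w
inits-last []      (p ∷ []) = p
inits-last (y ∷ w) (p ∷ ps) = inits-last w (Allₚ.map⁻ ps)

prefix-up⁻ : ∀ r w v → Prefix _≡_ (replicate r right) (w ++ up ∷ v) → Prefix _≡_ (replicate r right) w
prefix-up⁻ zero    w       v p          = []
prefix-up⁻ (suc r) []      v (() ∷ p)
prefix-up⁻ (suc r) (x ∷ w) v (eq ∷ p)   = eq ∷ prefix-up⁻ r w v p

-- An up step cuts runs: a run of r right steps lies entirely before or entirely
-- after it.
run-up⁻ : ∀ r w v → HasRightRun r (w ++ up ∷ v) → ¬ HasRightRun r v → HasRightRun r w
run-up⁻ r []      v (here p)  ¬v = here (prefix-up⁻ r [] v p)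
run-up⁻ r []      v (there i) ¬v = ⊥-elim (¬v i)
run-up⁻ r (x ∷ w) v (here p)  ¬v = here (prefix-up⁻ r (x ∷ w) v p)
run-up⁻ r (x ∷ w) v (there i) ¬v = there (run-up⁻ r w v i ¬v)

run-short : ∀ r j → j < r → ¬ HasRightRun r (replicate j right)
run-short r j j<r i = ℕₚ.<⇒≱ j<r
  (subst₂ _≤_ (Listₚ.length-replicate r) (Listₚ.length-replicate j) (length-mono i))

run-full : ∀ r w → HasRightRun r (w ++ replicate r right)
run-full r []      = here (Prefixₚ.fromPointwise (Pointwise.refl refl))
run-full r (x ∷ w) = there (run-full r w)

------------------------------------------------------------------------
-- Path counts with room for further right steps

module _ (r : ℕ) where
  -- Paths to (n,m) as in IsPath that stay free of runs of length r when j more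
  -- right steps are appended, wherever those steps would lead.  The number j
  -- records the right steps already removed from the end of a longer path.
  Extendable : ℕ → ℕ → ℕ → List Step → Set
  Extendable j n m w = EndsAt n m w × WeaklyAboveDiagonal w × ¬ HasRightRun r (w ++ replicate j right)

  extendable? : ∀ j n m → Decidable (Extendable j n m)
  extendable? j n m w =
    ((# right ∈ w ≟ n) ×-dec (# up ∈ w ≟ m))
    ×-dec all? (λ v → # right ∈ v ≤? # up ∈ v) (inits w)
    ×-dec ¬? (infix? _≟ˢ_ (replicate r right) (w ++ replicate j right))

  -- The number of extendable paths; for j = 0 it is pathCount.
  extendableCount : ℕ → ℕ → ℕ → ℕ
  extendableCount j n m = count (extendable? j n m) (words (n + m))

  extendableCount-0 : ∀ n m → extendableCount 0 n m ≡ pathCount r n m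
  extendableCount-0 n m = count-≐ (extendable? 0 n m) (isPath? r n m)
    ((λ {w} (e , a , ¬run) → e , a , subst (¬_ ∘ HasRightRun r) (Listₚ.++-identityʳ w) ¬run) ,
     (λ {w} (e , a , ¬run) → e , a , subst (¬_ ∘ HasRightRun r) (sym (Listₚ.++-identityʳ w)) ¬run)) (words (n + m))

  -- After an up step the j < r further right steps are harmless, and the up step
  -- itself cannot cross the diagonal.
  extendable-∷ʳup : ∀ j n m → j < r → (Extendable j n (suc m) ∘ (_∷ʳ up)) ≐ IsPath r n m
  extendable-∷ʳup j n m j<r = to , from
    where
    to : ∀ {w} → Extendable j n (suc m) (w ∷ʳ up) → IsPath r n m w
    to {w} ((rights , ups) , above , ¬run) =
      (trans (sym (#right-up w)) rights , ℕₚ.suc-injective (trans (sym (#up-up w)) ups)) ,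
      proj₁ (inits-∷ʳ⁻ w up above) ,
      λ run → ¬run ((run ⁱ++ (up ∷ [])) ⁱ++ replicate j right)
    from : ∀ {w} → IsPath r n m w → Extendable j n (suc m) (w ∷ʳ up)
    from {w} ((rights , ups) , above , ¬run) =
      (trans (#right-up w) rights , trans (#up-up w) (cong suc ups)) ,
      inits-∷ʳ⁺ w up above (subst₂ _≤_ (sym (#right-up w)) (sym (#up-up w)) (ℕₚ.m≤n⇒m≤1+n (inits-last w above))) ,
      λ run → ¬run (run-up⁻ r w (replicate j right)
        (subst (HasRightRun r) (Listₚ.++-assoc w (up ∷ []) (replicate j right)) run) (run-short r j j<r))

  -- A last right step joins the right steps to be appended.  It stays above the
  -- diagonal because n < m.
  extendable-∷ʳright : ∀ j n m → n < m → (Extendable j (suc n) m ∘ (_∷ʳ right)) ≐ Extendable (suc j) n m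
  extendable-∷ʳright j n m n<m = to , from
    where
    assoc : ∀ w → (w ∷ʳ right) ++ replicate j right ≡ w ++ replicate (suc j) right
    assoc w = Listₚ.++-assoc w (right ∷ []) (replicate j right)
    to : ∀ {w} → Extendable j (suc n) m (w ∷ʳ right) → Extendable (suc j) n m w
    to {w} ((rights , ups) , above , ¬run) =
      (ℕₚ.suc-injective (trans (sym (#right-right w)) rights) , trans (sym (#up-right w)) ups) ,
      proj₁ (inits-∷ʳ⁻ w right above) ,
      subst (¬_ ∘ HasRightRun r) (assoc w) ¬run
    from : ∀ {w} → Extendable (suc j) n m w → Extendable j (suc n) m (w ∷ʳ right)
    from {w} ((rights , ups) , above , ¬run) =
      (rights′ , ups′) ,
      inits-∷ʳ⁺ w right above (subst₂ _≤_ (sym rights′) (sym ups′) n<m) ,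
      subst (¬_ ∘ HasRightRun r) (sym (assoc w)) ¬run
      where
      rights′ = trans (#right-right w) (cong suc rights)
      ups′ = trans (#up-right w) ups

  extendableCount-axis : ∀ j m → j < r → extendableCount j 0 (suc m) ≡ pathCount r 0 m
  extendableCount-axis j m j<r = begin
    extendableCount j 0 (suc m)
      ≡⟨ count-snoc (extendable? j 0 (suc m)) m ⟩
    count (extendable? j 0 (suc m) ∘ (_∷ʳ up)) (words m) + count (extendable? j 0 (suc m) ∘ (_∷ʳ right)) (words m)
      ≡⟨ cong₂ _+_ (count-≐ (extendable? j 0 (suc m) ∘ (_∷ʳ up)) (isPath? r 0 m) (extendable-∷ʳup j 0 m j<r) (words m))
                   (count-none (extendable? j 0 (suc m) ∘ (_∷ʳ right))
                     (λ w e → ℕₚ.1+n≢0 (trans (sym (#right-right w)) (proj₁ (proj₁ e)))) (words m)) ⟩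
    pathCount r 0 m + 0
      ≡⟨ ℕₚ.+-identityʳ (pathCount r 0 m) ⟩
    pathCount r 0 m ∎

  extendableCount-suc : ∀ j n m → j < r → n ≤ m →
    extendableCount j (suc n) (suc m) ≡ pathCount r (suc n) m + extendableCount (suc j) n (suc m)
  extendableCount-suc j n m j<r n≤m = begin
    extendableCount j (suc n) (suc m)
      ≡⟨ count-snoc e? (n + suc m) ⟩
    count (e? ∘ (_∷ʳ up)) (words (n + suc m)) + count (e? ∘ (_∷ʳ right)) (words (n + suc m))
      ≡⟨ cong₂ _+_ (count-≐ (e? ∘ (_∷ʳ up)) (isPath? r (suc n) m) (extendable-∷ʳup j (suc n) m j<r) (words (n + suc m)))
                   (count-≐ (e? ∘ (_∷ʳ right)) (extendable? (suc j) n (suc m)) (extendable-∷ʳright j n (suc m) (s≤s n≤m)) (words (n + suc m))) ⟩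
    count (isPath? r (suc n) m) (words (n + suc m)) + extendableCount (suc j) n (suc m)
      ≡⟨ cong (λ k → count (isPath? r (suc n) m) (words k) + extendableCount (suc j) n (suc m)) (ℕₚ.+-suc n m) ⟩
    pathCount r (suc n) m + extendableCount (suc j) n (suc m) ∎
    where e? = extendable? j (suc n) (suc m)

  extendableCount-r : ∀ n m → extendableCount r n m ≡ 0
  extendableCount-r n m = count-none (extendable? r n m) (λ w e → proj₂ (proj₂ e) (run-full r w)) (words (n + m))

  pathCount-below : ∀ n m → m < n → pathCount r n m ≡ 0
  pathCount-below n m m<n = count-none (isPath? r n m)
    (λ { w ((rights , ups) , above , _) → ℕₚ.<⇒≱ m<n (subst₂ _≤_ rights ups (inits-last w above)) }) (words (n + m))

pathCount-origin : ∀ r .{{_ : NonZero r}} → pathCount r 0 0 ≡ 1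
pathCount-origin (suc r) = refl

------------------------------------------------------------------------
-- The series whose coefficients are the path counts

-- The coefficients of (f - t f') f^m, where f = ones r and xd f = t f'.
ballot : ℕ → ℕ → Seq
ballot r m n = act (ones r) c n ℚ.- act (xd (ones r)) c n
  where c = coeff (ones r ^ₚ m)

ballot-formula : ∀ r m n →
  fromℕ (suc m) ℚ.* ballot r m n ≡ (fromℕ (suc m) ℚ.- fromℕ n) ℚ.* coeff (ones r ^ₚ suc m) n
ballot-formula r m n = begin
  fromℕ (suc m) ℚ.* (y ℚ.- z)                   ≡⟨ solve 3 (λ f y z → f :* (y :- z) := f :* y :- f :* z) refl (fromℕ (suc m)) y z ⟩
  fromℕ (suc m) ℚ.* y ℚ.- fromℕ (suc m) ℚ.* z      ≡⟨ cong₂ (λ u v → fromℕ (suc m) ℚ.* u ℚ.- v) (coeff-*ₚ (ones r) (ones r ^ₚ m) n) (θ-^ₚ (ones r) m n) ⟨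
  fromℕ (suc m) ℚ.* x ℚ.- fromℕ n ℚ.* x            ≡⟨ solve 3 (λ f g x → f :* x :- g :* x := (f :- g) :* x) refl (fromℕ (suc m)) (fromℕ n) x ⟩
  (fromℕ (suc m) ℚ.- fromℕ n) ℚ.* x                ∎
  where
  x = coeff (ones r ^ₚ suc m) n
  y = act (ones r) (coeff (ones r ^ₚ m)) n
  z = act (xd (ones r)) (coeff (ones r ^ₚ m)) n

ballot-suc : ∀ r m → ballot r (suc m) ≗ act (ones r) (ballot r m)
ballot-suc r m n = begin
  act f (coeff (f ^ₚ suc m)) n ℚ.- act (xd f) (coeff (f ^ₚ suc m)) n
    ≡⟨ cong₂ ℚ._-_ (act-cong f (coeff-*ₚ f (f ^ₚ m)) n)
         (trans (act-cong (xd f) (coeff-*ₚ f (f ^ₚ m)) n) (act-comm (xd f) f c n)) ⟩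
  act f y n ℚ.- act f z n
    ≡⟨ solve 2 (λ a b → a :- b := a :+ con (- 1ℚ) :* b) refl (act f y n) (act f z n) ⟩
  act f y n ℚ.+ (- 1ℚ) ℚ.* act f z n
    ≡⟨ cong (act f y n ℚ.+_) (act-scale f (- 1ℚ) z n) ⟨
  act f y n ℚ.+ act f (λ i → (- 1ℚ) ℚ.* z i) n
    ≡⟨ act-⊕ f y (λ i → (- 1ℚ) ℚ.* z i) n ⟨
  act f (y ⊕ (λ i → (- 1ℚ) ℚ.* z i)) n
    ≡⟨ act-cong f (λ i → solve 2 (λ a b → a :+ con (- 1ℚ) :* b := a :- b) refl (y i) (z i)) n ⟩
  act f (ballot r m) n ∎
  where
  f = ones r
  c = coeff (f ^ₚ m)
  y = act f c
  z = act (xd f) c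

-- The factor m + 1 - n in ballot-formula is zero at n = m + 1.
ballot-boundary : ∀ r m → ballot r m (suc m) ≡ 0ℚ
ballot-boundary r m = fromℕ-suc-cancel m (begin
  fromℕ (suc m) ℚ.* ballot r m (suc m)    ≡⟨ ballot-formula r m (suc m) ⟩
  (fromℕ (suc m) ℚ.- fromℕ (suc m)) ℚ.* x    ≡⟨ cong (ℚ._* x) (ℚₚ.+-inverseʳ (fromℕ (suc m))) ⟩
  0ℚ ℚ.* x                             ≡⟨ trans (ℚₚ.*-zeroˡ x) (sym (ℚₚ.*-zeroʳ (fromℕ (suc m)))) ⟩
  fromℕ (suc m) ℚ.* 0ℚ                    ∎)
  where x = coeff (ones r ^ₚ suc m) (suc m)

ballot-origin : ∀ r .{{_ : NonZero r}} → ballot r 0 0 ≡ 1ℚ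
ballot-origin (suc r) = refl

module _ (r : ℕ) .{{_ : NonZero r}} where

  -- The generating series of the path counts to the points at height m.
  paths : ℕ → Seq
  paths m n = fromℕ (pathCount r n m)

  -- With j right steps already removed, at most d - 1 more can be, so that the
  -- row m + 1 is 1 + t + ... + t^(d-1) times the row m, in degrees n <= m + 1.
  paths-suc-run : ∀ m d j → j + d ≡ r → ∀ n → n ≤ suc m →
    fromℕ (extendableCount r j n (suc m)) ≡ act (ones d) (paths m) n
  paths-suc-run m zero    j eq n n≤1+m = cong fromℕ (trans
    (cong (λ i → extendableCount r i n (suc m)) (trans (sym (ℕₚ.+-identityʳ j)) eq)) (extendableCount-r r n (suc m)))
  paths-suc-run m (suc d) j eq n n≤1+m = step n n≤1+m
    where
    j<r : j < r
    j<r = subst (j <_) eq (ℕₚ.m<m+n j (s≤s z≤n))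
    step : ∀ n → n ≤ suc m → fromℕ (extendableCount r j n (suc m)) ≡ act (ones (suc d)) (paths m) n
    step zero    n≤1+m     = begin
      fromℕ (extendableCount r j 0 (suc m))     ≡⟨ cong fromℕ (extendableCount-axis r j m j<r) ⟩
      paths m 0                              ≡⟨ solve 1 (λ x → x := con 1ℚ :* x :+ con 0ℚ) refl (paths m 0) ⟩
      1ℚ ℚ.* paths m 0 ℚ.+ 0ℚ                ∎
    step (suc n) (s≤s n≤m) = begin
      fromℕ (extendableCount r j (suc n) (suc m))
        ≡⟨ cong fromℕ (extendableCount-suc r j n m j<r n≤m) ⟩
      fromℕ (pathCount r (suc n) m + extendableCount r (suc j) n (suc m))
        ≡⟨ fromℕ-+ (pathCount r (suc n) m) (extendableCount r (suc j) n (suc m)) ⟩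
      paths m (suc n) ℚ.+ fromℕ (extendableCount r (suc j) n (suc m))
        ≡⟨ cong₂ ℚ._+_ (sym (ℚₚ.*-identityˡ (paths m (suc n))))
             (paths-suc-run m d (suc j) (trans (sym (ℕₚ.+-suc j d)) eq) n (ℕₚ.m≤n⇒m≤1+n n≤m)) ⟩
      1ℚ ℚ.* paths m (suc n) ℚ.+ act (ones d) (paths m) n ∎

  paths-suc : ∀ m n → n ≤ suc m → paths (suc m) n ≡ act (ones r) (paths m) n
  paths-suc m n n≤1+m = trans (cong fromℕ (sym (extendableCount-0 r n (suc m)))) (paths-suc-run m r 0 refl n n≤1+m)

  paths≡ballot : ∀ m n → n ≤ suc m → paths m n ≡ ballot r m n
  paths≡ballot m n n≤1+m = boundary-or-below (ℕₚ.m≤n⇒m<n∨m≡n n≤1+m)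
    where
    below : ∀ m n → n ≤ m → paths m n ≡ ballot r m n
    below zero    zero n≤m   = trans (cong fromℕ (pathCount-origin r)) (sym (ballot-origin r))
    below (suc m) n    n≤1+m = begin
      paths (suc m) n                ≡⟨ paths-suc m n n≤1+m ⟩
      act (ones r) (paths m) n       ≡⟨ act-local (ones r) n (λ i i≤n → paths≡ballot m i (ℕₚ.≤-trans i≤n n≤1+m)) ⟩
      act (ones r) (ballot r m) n    ≡⟨ ballot-suc r m n ⟨
      ballot r (suc m) n             ∎
    boundary-or-below : n < suc m ⊎ n ≡ suc m → paths m n ≡ ballot r m n
    boundary-or-below (inj₁ (s≤s n≤m)) = below m n n≤m
    boundary-or-below (inj₂ n≡1+m)     = begin
      paths m n          ≡⟨ cong fromℕ (pathCount-below r n m (ℕₚ.≤-reflexive (sym n≡1+m))) ⟩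
      0ℚ                 ≡⟨ ballot-boundary r m ⟨
      ballot r m (suc m) ≡⟨ cong (ballot r m) n≡1+m ⟨
      ballot r m n       ∎

  -- On and above the diagonal s is given by the path counts; on the row n = 0,
  -- where it is 1 by definition, there is exactly one path.
  s≡ballot : ∀ n m → n ≤ m → ι (s r (+ n) (+ m)) ≡ ballot r m n
  s≡ballot n m n≤m = trans (s≡paths n n≤m) (paths≡ballot m n (ℕₚ.m≤n⇒m≤1+n n≤m))
    where
    axis : ∀ m → pathCount r 0 m ≡ 1
    axis zero    = pathCount-origin r
    axis (suc m) = trans (sym (extendableCount-0 r 0 (suc m))) (trans (extendableCount-axis r 0 m (ℕₚ.n≢0⇒n>0 (≢-nonZero⁻¹ r))) (axis m))
    s≡paths : ∀ n → n ≤ m → ι (s r (+ n) (+ m)) ≡ paths m n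
    s≡paths zero    n≤m = cong fromℕ (sym (axis m))
    s≡paths (suc n) n≤m = subst (λ m → ι (s r (+ suc n) (+ m)) ≡ paths m (suc n)) (ℕₚ.m+[n∸m]≡n n≤m)
      (cong ι (s-onOrAbove r n (m ∸ suc n)))

------------------------------------------------------------------------
-- Values of both sides at the naturals

-- At x = m the Euler coefficient for x + 1 is the coefficient of a genuine power.
eval-eulerCoeff : ∀ r .{{_ : NonZero r}} n m →
  eval (eulerCoeff r (X +ₚ nat 1) n) (fromℕ m) ≡ coeff (ones r ^ₚ suc m) n
eval-eulerCoeff r n m = begin
  eval (eulerCoeff r (X +ₚ nat 1) n) (fromℕ m)
    ≡⟨ eval-∑≤ n (λ k → coeff (g ^ₚ k) n ·ₚ binom (X +ₚ nat 1) k) (fromℕ m) ⟩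
  sum≤ n (λ k → eval (coeff (g ^ₚ k) n ·ₚ binom (X +ₚ nat 1) k) (fromℕ m))
    ≡⟨ sum≤-cong n (λ k _ → term k) ⟩
  sum≤ n (λ k → bin (fromℕ (suc m)) k ℚ.* coeff (g ^ₚ k) n)
    ≡⟨ ^ₚ-expansion (ones r) (g₀ r) (suc m) n ⟨
  coeff (ones r ^ₚ suc m) n ∎
  where
  g = ones r -ₚ const 1ℚ
  g₀ : ∀ r .{{_ : NonZero r}} → coeff (ones r -ₚ const 1ℚ) 0 ≡ 0ℚ
  g₀ (suc r) = refl
  term : ∀ k → eval (coeff (g ^ₚ k) n ·ₚ binom (X +ₚ nat 1) k) (fromℕ m) ≡ bin (fromℕ (suc m)) k ℚ.* coeff (g ^ₚ k) n
  term k = begin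
    eval (a ·ₚ binom (X +ₚ nat 1) k) (fromℕ m)       ≡⟨ eval-·ₚ a (binom (X +ₚ nat 1) k) (fromℕ m) ⟩
    a ℚ.* eval (binom (X +ₚ nat 1) k) (fromℕ m)      ≡⟨ cong (a ℚ.*_) (eval-binom (X +ₚ nat 1) k (fromℕ m)) ⟩
    a ℚ.* bin (eval (X +ₚ nat 1) (fromℕ m)) k        ≡⟨ cong (λ y → a ℚ.* bin y k) (eval-X+1 m) ⟩
    a ℚ.* bin (fromℕ (suc m)) k                      ≡⟨ ℚₚ.*-comm a (bin (fromℕ (suc m)) k) ⟩
    bin (fromℕ (suc m)) k ℚ.* a                      ∎
    where
    a = coeff (g ^ₚ k) n

eval-explicitSum : ∀ r .{{_ : NonZero r}} n m →
  eval (∑≤ (n / r) (λ i → const (- 1ℚ) ^ₚ i *ₚ binom (X +ₚ nat 1) i *ₚ binom (X +ₚ nat (n ∸ r * i)) (n ∸ r * i))) (fromℕ m)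
  ≡ coeff (ones r ^ₚ suc m) n
eval-explicitSum r n m = begin
  eval (∑≤ (n / r) (λ i → signₚ i *ₚ binom (X +ₚ nat 1) i *ₚ binomₚ i)) x
    ≡⟨ eval-∑≤ (n / r) (λ i → signₚ i *ₚ binom (X +ₚ nat 1) i *ₚ binomₚ i) x ⟩
  sum≤ (n / r) (λ i → eval (signₚ i *ₚ binom (X +ₚ nat 1) i *ₚ binomₚ i) x)
    ≡⟨ sum≤-cong (n / r) (λ i _ → term i) ⟩
  sum≤ (n / r) (λ i → sign i ℚ.* bin (fromℕ (suc m)) i ℚ.* bin (x ℚ.+ fromℕ (n ∸ r * i)) (n ∸ r * i))
    ≡⟨ ones-^ₚ-explicit r m n ⟨
  coeff (ones r ^ₚ suc m) n ∎
  where
  x = fromℕ m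
  signₚ binomₚ : ℕ → Poly
  signₚ i = const (- 1ℚ) ^ₚ i
  binomₚ i = binom (X +ₚ nat (n ∸ r * i)) (n ∸ r * i)
  term : ∀ i → eval (signₚ i *ₚ binom (X +ₚ nat 1) i *ₚ binomₚ i) x ≡
         sign i ℚ.* bin (fromℕ (suc m)) i ℚ.* bin (x ℚ.+ fromℕ (n ∸ r * i)) (n ∸ r * i)
  term i = begin
    eval (signₚ i *ₚ binom (X +ₚ nat 1) i *ₚ binomₚ i) x
      ≡⟨ eval-*ₚ (signₚ i *ₚ binom (X +ₚ nat 1) i) (binomₚ i) x ⟩
    eval (signₚ i *ₚ binom (X +ₚ nat 1) i) x ℚ.* eval (binomₚ i) x
      ≡⟨ cong (ℚ._* eval (binomₚ i) x) (eval-*ₚ (signₚ i) (binom (X +ₚ nat 1) i) x) ⟩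
    eval (signₚ i) x ℚ.* eval (binom (X +ₚ nat 1) i) x ℚ.* eval (binomₚ i) x
      ≡⟨ cong₂ ℚ._*_ (cong₂ ℚ._*_ (eval-sign i x) (trans (eval-binom (X +ₚ nat 1) i x) (cong (λ y → bin y i) (eval-X+1 m))))
           (trans (eval-binom (X +ₚ nat j) j x) (cong (λ y → bin y j) (eval-X+nat j x))) ⟩
    sign i ℚ.* bin (fromℕ (suc m)) i ℚ.* bin (x ℚ.+ fromℕ j) j ∎
    where j = n ∸ r * i

theorem5 : (r : ℕ) .{{_ : NonZero r}} (S : ℕ → Poly) → Extends r S → (n : ℕ) →
    (fromPoly (S n) ≈ (X -ₚ nat n +ₚ nat 1) /x+1 *ᵣ eulerCoeff r (X +ₚ nat 1) n)
    ×
    ((X -ₚ nat n +ₚ nat 1) /x+1 *ᵣ eulerCoeff r (X +ₚ nat 1) n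
    ≈ (X -ₚ nat n +ₚ nat 1) /x+1 *ᵣ
    ∑≤ (n / r) (λ i → const (- 1ℚ) ^ₚ i *ₚ binom (X +ₚ nat 1) i *ₚ binom (X +ₚ nat (n ∸ r * i)) (n ∸ r * i)))
theorem5 r S extends n = identity-theorem (S n *ₚ x+1) (factor *ₚ euler *ₚ const 1ℚ) n first ,
  identity-theorem (factor *ₚ euler *ₚ x+1) (factor *ₚ explicit *ₚ x+1) n second
  where
  x+1      = X +ₚ nat 1
  factor   = X -ₚ nat n +ₚ nat 1
  euler    = eulerCoeff r x+1 n
  explicit = ∑≤ (n / r) (λ i → const (- 1ℚ) ^ₚ i *ₚ binom x+1 i *ₚ binom (X +ₚ nat (n ∸ r * i)) (n ∸ r * i))
  eval-factor : ∀ m → eval factor (fromℕ m) ≡ fromℕ (suc m) ℚ.- fromℕ n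
  eval-factor m = begin
    eval factor (fromℕ m)                                 ≡⟨ eval-+ₚ (X -ₚ nat n) (nat 1) (fromℕ m) ⟩
    eval (X -ₚ nat n) (fromℕ m) ℚ.+ eval (nat 1) (fromℕ m)
      ≡⟨ cong₂ ℚ._+_ (trans (eval--ₚ X (nat n) (fromℕ m)) (cong₂ ℚ._-_ (eval-X (fromℕ m)) (eval-const (fromℕ n) (fromℕ m))))
                     (eval-const (fromℕ 1) (fromℕ m)) ⟩
    fromℕ m ℚ.- fromℕ n ℚ.+ 1ℚ
      ≡⟨ solve 2 (λ m n → m :- n :+ con 1ℚ := con 1ℚ :+ m :- n) refl (fromℕ m) (fromℕ n) ⟩
    1ℚ ℚ.+ fromℕ m ℚ.- fromℕ n                            ≡⟨ cong (λ y → y ℚ.- fromℕ n) (fromℕ-suc m) ⟨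
    fromℕ (suc m) ℚ.- fromℕ n                             ∎
  first : ∀ m → n ≤ m → eval (S n *ₚ x+1) (fromℕ m) ≡ eval (factor *ₚ euler *ₚ const 1ℚ) (fromℕ m)
  first m n≤m = begin
    eval (S n *ₚ x+1) x                                   ≡⟨ eval-*ₚ (S n) x+1 x ⟩
    eval (S n) x ℚ.* eval x+1 x                           ≡⟨ cong₂ ℚ._*_ (trans (extends n (+ m)) (s≡ballot r n m n≤m)) (eval-X+1 m) ⟩
    ballot r m n ℚ.* fromℕ (suc m)                        ≡⟨ ℚₚ.*-comm (ballot r m n) (fromℕ (suc m)) ⟩
    fromℕ (suc m) ℚ.* ballot r m n                        ≡⟨ ballot-formula r m n ⟩
    (fromℕ (suc m) ℚ.- fromℕ n) ℚ.* coeff (ones r ^ₚ suc m) n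
      ≡⟨ cong₂ ℚ._*_ (eval-factor m) (eval-eulerCoeff r n m) ⟨
    eval factor x ℚ.* eval euler x                        ≡⟨ eval-*ₚ factor euler x ⟨
    eval (factor *ₚ euler) x                              ≡⟨ ℚₚ.*-identityʳ (eval (factor *ₚ euler) x) ⟨
    eval (factor *ₚ euler) x ℚ.* 1ℚ                       ≡⟨ cong (eval (factor *ₚ euler) x ℚ.*_) (eval-const 1ℚ x) ⟨
    eval (factor *ₚ euler) x ℚ.* eval (const 1ℚ) x        ≡⟨ eval-*ₚ (factor *ₚ euler) (const 1ℚ) x ⟨
    eval (factor *ₚ euler *ₚ const 1ℚ) x                  ∎
    where x = fromℕ m
  second : ∀ m → n ≤ m → eval (factor *ₚ euler *ₚ x+1) (fromℕ m) ≡ eval (factor *ₚ explicit *ₚ x+1) (fromℕ m)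
  second m _ = begin
    eval (factor *ₚ euler *ₚ x+1) x                       ≡⟨ eval-product euler ⟩
    eval factor x ℚ.* eval euler x ℚ.* eval x+1 x
      ≡⟨ cong (λ y → eval factor x ℚ.* y ℚ.* eval x+1 x) (trans (eval-eulerCoeff r n m) (sym (eval-explicitSum r n m))) ⟩
    eval factor x ℚ.* eval explicit x ℚ.* eval x+1 x      ≡⟨ eval-product explicit ⟨
    eval (factor *ₚ explicit *ₚ x+1) x                    ∎
    where
    x = fromℕ m
    eval-product : ∀ p → eval (factor *ₚ p *ₚ x+1) x ≡ eval factor x ℚ.* eval p x ℚ.* eval x+1 x
    eval-product p = trans (eval-*ₚ (factor *ₚ p) x+1 x) (cong (ℚ._* eval x+1 x) (eval-*ₚ factor p x))
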